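{- For any real $V_{\max}>0$, any $d>r$ (where $r>0$ is the range of transmission and $d$ is the Geocast eccentricity), any $0<\varepsilon<1$, any integers $\alpha\ge 0$, $\beta>0$, any integers $n,k,c$ with $45\le k<n$ and $c>0$, and any fair randomized protocol $\mathcal{P}$ for Geocast, there exists an $(\alpha,\beta)$-connected MANET formed by a set $V$ of $n$ nodes running $\mathcal{P}$ (node speeds bounded by $V_{\max}$) such that, if $T\le \dfrac{k\log_4(1/\varepsilon)}{4\log_2 k}$, then, within $cT$ time steps after $k$ nodes are covered, no new node is covered with probability at least $\varepsilon^{c}$. This holds even if all nodes are activated simultaneously and do not fail.
   Context: **Model.** A MANET is a set $V$ of $n$ nodes in $\mathbb{R}^2$, no two at the same point at the same time. Time is divided into slots $1,2,\dots$; positions (hence topology) change only at slot boundaries, and no node moves faster than $V_{\max}$ (measured as distance per time slot). All nodes have the same range of transmission $r>0$; two nodes are neighbors in a slot if their distance is at most $r$ during the whole slot. An active node $u$ receives a transmission from a neighbor $v$ in a slot if and only if $v$ is the only node transmitting in that slot among $u$ and its neighbors. There is no collision detection. Nodes may be activated at any slot boundary, and may fail (become inactive) and be reactivated; upon activation a node starts its algorithm from scratch, keeping no state. Slots counted from a node's activation are its (local) steps. **Geocast.** A source node $s$ holds a piece of information $I$ at time $t_1$. $I$ must be delivered to all nodes that at time $t_1$ are active and located within distance $d$ (the eccentricity) of the position of $s$ at that time. A node is covered if it has received $I$ (the source counts as covered from $t_1$), otherwise uncovered. A node is informed at time $t$ if it holds $I$ at time $t$. The problem is solved at slot $t_2\ge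 t_1$ if all target nodes are covered by slot $t_2$. **$(\alpha,\beta)$-connectivity** (integers $\alpha\ge0$, $\beta\ge1$). For every slot $t\ge t_1$ at which the problem is not yet solved there is a slot $t'$ such that $[t,t+\alpha]\cap[t',t'+\beta)\neq\emptyset$, and there are nodes $p,p'$ such that at time $t'$ $p$ is informed and $p'$ is uncovered, and $p,p'$ are active and neighbors from step $t'$ until $p'$ becomes covered or until step $t'+\beta-1$ (inclusive), whichever occurs first. **Adversary.** Placement, movement and activation schedule (and the instance: source and $t_1$) are chosen by an adaptive adversary, which decides at the end of each slot with access to the protocol and all nodes' internal states but not to future random bits, subject to the speed bound and $(\alpha,\beta)$-connectivity. "There exists an $(\alpha,\beta)$-connected MANET" means that there is such an adversary strategy. Probability is over the protocol's random bits. **Protocols.** Protocols are conditional: a node does not transmit before it is covered. A randomized protocol is fair if in every execution and every (global) time slot all covered nodes transmit with the same probability (this common probability may depend on the slot and on the execution). "Within $cT$ steps after $k$ nodes are covered" refers to the $cT$ slots following the slot at which the number of covered nodes reaches $k$; if that event never happens the assertion is considered to hold trivially. -}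

module Defs where

open import Algebra.Bundles using (CommutativeRing; RawSemiring; Semiring)
open import Data.Bool.Base using (Bool; true; false; if_then_else_; T; _∧_; _∨_)
open import Data.Bool.Properties using (T?)
open import Data.Fin.Base using (Fin; zero; suc; toℕ)
open import Data.Fin.Properties using (any?; all?; _≟_)
open import Data.Fin.Subset using (Subset)
open import Data.Fin.Subset.Properties using (_⊆?_)
open import Data.List.Base using (List; []; _∷_; length)
open import Data.Maybe.Base using (Maybe; just; nothing; is-just; fromMaybe)
import Data.Maybe.Base as Maybe
open import Data.Nat.Base as ℕ using (ℕ; zero; suc; _≡ᵇ_; _≤ᵇ_)
open import Data.Product.Base using (_×_; _,_; proj₁; proj₂; ∃; ∃-syntax; ∃₂; map₂)
open import Data.Sum.Base using (_⊎_)
open import Data.Vec.Base using (tabulate)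
open import Data.Vec.Functional as Vector using (Vector)
open import Function.Base using (_∘_; const)
open import Level using (0ℓ)
open import Relation.Binary.PropositionalEquality.Core using (_≡_; _≢_)
open import Relation.Binary.Structures using (IsDecTotalOrder)
open import Relation.Nullary.Decidable.Core
  using (Dec; yes; no; does; ¬?; _×-dec_; _→-dec_; _⊎-dec_)
open import Relation.Nullary.Negation.Core using (¬_)
import Algebra.Definitions.RawSemiring as RawSemiringDefinitions
import Relation.Binary.Construct.NonStrictToStrict as ToStrict

-- The real numbers, classically: a Dedekind-complete ordered field (unique up
-- to isomorphism).  The inverse and the supremum are total operations; they
-- carry no meaning at 0 and at sets that are empty or unbounded above.
record Reals : Set₁ where
  infix  4 _≤_
  infixl 7 _/_
  infix  8 _⁻¹
  field
    commutativeRing : CommutativeRing 0ℓ 0ℓ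

  open CommutativeRing commutativeRing public
    using (_≈_; _≉_; _+_; _*_; _-_; -_; 0#; 1#; semiring)
    renaming (Carrier to ℝ)

  private
    rawSemiring : RawSemiring 0ℓ 0ℓ
    rawSemiring = Semiring.rawSemiring semiring

  field
    _≤_             : ℝ → ℝ → Set
    isDecTotalOrder : IsDecTotalOrder _≈_ _≤_
    +-monoˡ-≤       : ∀ z {x y} → x ≤ y → x + z ≤ y + z
    *-nonNegative   : ∀ {x y} → 0# ≤ x → 0# ≤ y → 0# ≤ x * y
    0≉1             : 0# ≉ 1#
    _⁻¹             : ℝ → ℝ
    *-inverseʳ      : ∀ x → x ≉ 0# → x * x ⁻¹ ≈ 1#

  IsUpperBound : (ℝ → Set) → ℝ → Set
  IsUpperBound S b = ∀ x → S x → x ≤ b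

  IsSupremum : (ℝ → Set) → ℝ → Set
  IsSupremum S s = IsUpperBound S s × (∀ b → IsUpperBound S b → s ≤ b)

  field
    sup            : (ℝ → Set) → ℝ
    sup-isSupremum : ∀ S → ∃ S → ∃ (IsUpperBound S) → IsSupremum S (sup S)

  open IsDecTotalOrder isDecTotalOrder public using (_≤?_)
  open ToStrict _≈_ _≤_ public using (_<_)
  open RawSemiringDefinitions rawSemiring public using (_^_; sum)

  _/_ : ℝ → ℝ → ℝ
  x / y = x * y ⁻¹

  fromℕ : ℕ → ℝ
  fromℕ m = RawSemiringDefinitions._×_ rawSemiring m 1#

  √ : ℝ → ℝ
  √ x = sup λ y → y * y ≤ x

  -- Logarithm for b > 1 and x ≥ 1: a fraction p/q lies below log b x exactly
  -- when b ^ p ≤ x ^ q.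
  log : (b x : ℝ) → ℝ
  log b x = sup λ y → ∃₂ λ p q →
    0 ℕ.< q × b ^ p ≤ x ^ q × y ≈ fromℕ p / fromℕ q

module Probability (𝓡 : Reals) where
  open Reals 𝓡

  partialSum : (ℕ → ℝ) → ℕ → ℝ
  partialSum f N = sum {N} (f ∘ toℕ)

  -- Series of nonnegative terms.
  ∑ : (ℕ → ℝ) → ℝ
  ∑ f = sup λ x → ∃[ N ] x ≈ partialSum f N

  -- Countably supported distributions.  Values may repeat and weights may be
  -- 0, so finitely supported distributions are included.
  record Dist (A : Set) : Set where
    field
      value       : ℕ → A
      weight      : ℕ → ℝ
      nonNegative : ∀ i → 0# ≤ weight i
      total       : IsSupremum (λ x → ∃[ N ] x ≈ partialSum weight N) 1#

  open Dist public

  _∈supp_ : {A : Set} → A → Dist A → Set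
  a ∈supp D = ∃[ i ] 0# < weight D i × value D i ≡ a

  mapDist : {A B : Set} → (A → B) → Dist A → Dist B
  mapDist f D = record
    { value       = f ∘ value D
    ; weight      = weight D
    ; nonNegative = nonNegative D
    ; total       = total D
    }

  -- Expectation of a nonnegative function.
  𝔼 : {A : Set} → Dist A → (A → ℝ) → ℝ
  𝔼 D f = ∑ λ i → weight D i * f (value D i)

  -- Expectation under the product of the given distributions.
  𝔼ⁿ : ∀ {n} {A : Set} → Vector (Dist A) n → (Vector A n → ℝ) → ℝ
  𝔼ⁿ {zero}  D f = f Vector.[]
  𝔼ⁿ {suc n} D f =
    𝔼 (Vector.head D) λ a → 𝔼ⁿ (Vector.tail D) λ as → f (a Vector.∷ as)

  indicator : Bool → ℝ
  indicator b = if b then 1# else 0#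

module Network (𝓡 : Reals) where
  open Reals 𝓡
  open Probability 𝓡

  Point : Set
  Point = ℝ × ℝ

  _≈ₚ_ : Point → Point → Set
  (x , y) ≈ₚ (x′ , y′) = x ≈ x′ × y ≈ y′

  dist : Point → Point → ℝ
  dist (x , y) (x′ , y′) = √ ((x - x′) * (x - x′) + (y - y′) * (y - y′))

  -- In each slot an active node draws a message to transmit (or nothing) and a
  -- new state, and then updates that state with the message received, if any.
  -- Any other random choice can be made as part of the next draw.  The initial
  -- state may depend on the node (identifiers) and on the slot of activation
  -- (global clock).
  record Protocol (n : ℕ) : Set₁ where
    field
      State Message : Set
      init     : Fin n → ℕ → State
      obtain   : State → State                       -- the source obtains I
      act      : State → Dist (Maybe Message × State)
      receive  : State → Maybe Message → State
      carriesI : Message → Bool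

  module _ {n : ℕ} (P : Protocol n) where
    open Protocol P

    record Node : Set where
      field
        status   : Maybe State    -- nothing when inactive
        informed : Bool           -- holds I now; lost upon failure
        covered  : Bool           -- has obtained I at some time

    -- A completed slot: `before` is the situation once the changes at the
    -- boundary starting the slot have been made.
    record Round : Set where
      field
        position      : Fin n → Point
        before after  : Fin n → Node
        transmission  : Fin n → Maybe Message

    -- Completed slots, latest first.  Slots are numbered from 0, so that a
    -- history h is followed by slot `length h`.
    History : Set
    History = List Round

    -- Decides, given everything up to the end of a slot, about the next one.
    record Adversary : Set where
      field
        source   : Fin n
        t₁       : ℕ
        position : History → Fin n → Point
        active   : History → Fin n → Bool

    -- For each node, its transmission and its state after the draw.
    Outcome : Set
    Outcome = Vector (Maybe Message × Maybe State) n

  module _ {n : ℕ} {P : Protocol n} where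
    open Protocol P
    open Node
    open Adversary

    final : History P → Fin n → Node P
    final []      v = record { status = nothing ; informed = false ; covered = false }
    final (ρ ∷ _) v = Round.after ρ v

    coveredSet : History P → Subset n
    coveredSet h = tabulate (covered ∘ final h)

    activate : ℕ → Fin n → Bool → Node P → Node P
    activate t v false x = record x { status = nothing ; informed = false }
    activate t v true  x = record x { status = just (fromMaybe (init v t) (status x)) }

    giveI : Node P → Node P
    giveI x = record
      { status = Maybe.map obtain (status x) ; informed = true ; covered = true }

    -- The nodes at the beginning of slot `length h`.
    start : Adversary P → History P → Fin n → Node P
    start A h v = if (length h ≡ᵇ t₁ A) ∧ does (v ≟ source A) then giveI x else x
      where x = activate (length h) v (active A h v) (final h v)

    inactiveLaw : Dist (Maybe Message × State) → Dist (Maybe Message × Maybe State)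
    inactiveLaw = mapDist (const (nothing , nothing))

    -- An inactive node is silent; the distribution its constant outcome is
    -- pushed forward from is irrelevant.
    law : ℕ → Fin n → Node P → Dist (Maybe Message × Maybe State)
    law t v x with status x
    ... | nothing = inactiveLaw (act (init v t))
    ... | just σ  = mapDist (map₂ just) (act σ)

    Possible : Adversary P → History P → Outcome P → Set
    Possible A h ω = ∀ v → ω v ∈supp law (length h) v (start A h v)

    transmitProbability : State → ℝ
    transmitProbability σ = 𝔼 (act σ) (indicator ∘ is-just ∘ proj₁)

    module _ (r : ℝ) where

      Neighbours : (Fin n → Point) → Fin n → Fin n → Set
      Neighbours pos u v = u ≢ v × dist (pos u) (pos v) ≤ r

      neighbours? : ∀ pos u v → Dec (Neighbours pos u v)
      neighbours? pos u v = ¬? (u ≟ v) ×-dec dist (pos u) (pos v) ≤? r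

      Transmits : (Fin n → Maybe Message) → Fin n → Set
      Transmits tx v = T (is-just (tx v))

      ReceivesFrom : (Fin n → Point) → (Fin n → Maybe Message) → Fin n → Fin n → Set
      ReceivesFrom pos tx u v =
        Neighbours pos u v × Transmits tx v ×
        (∀ w → w ≡ u ⊎ Neighbours pos u w → Transmits tx w → w ≡ v)

      receivesFrom? : ∀ pos tx u v → Dec (ReceivesFrom pos tx u v)
      receivesFrom? pos tx u v =
        neighbours? pos u v ×-dec T? (is-just (tx v)) ×-dec
        all? λ w → (w ≟ u ⊎-dec neighbours? pos u w) →-dec
                   (T? (is-just (tx w)) →-dec w ≟ v)

      -- What u hears: the message, and whether it brings I along.
      heard : (Fin n → Point) → (Fin n → Node P) → (Fin n → Maybe Message) →
              Fin n → Maybe Message × Bool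
      heard pos nodes tx u with any? (receivesFrom? pos tx u)
      ... | no  _       = nothing , false
      ... | yes (v , _) =
        tx v , informed (nodes v) ∧ Maybe.maybe′ carriesI false (tx v)

      update : Node P → Maybe State → Maybe Message × Bool → Node P
      update x nothing  _       = x
      update x (just σ) (m , i) = record
        { status   = just (receive σ m)
        ; informed = informed x ∨ i
        ; covered  = covered x ∨ i
        }

      round : Adversary P → History P → Outcome P → Round P
      round A h ω = record
        { position     = pos
        ; before       = nodes
        ; after        = λ v → update (nodes v) (proj₂ (ω v)) (heard pos nodes tx v)
        ; transmission = tx
        }
        where
          pos   = position A h
          nodes = start A h
          tx    = proj₁ ∘ ω

      extend : Adversary P → History P → Outcome P → History P
      extend A h ω = round A h ω ∷ h

      data Reachable (A : Adversary P) : History P → Set where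
        []  : Reachable A []
        _▷_ : ∀ {h ω} → Reachable A h → Possible A h ω → Reachable A (extend A h ω)

      -- The probability, given the history h, that the history m slots later
      -- satisfies E.
      Pr : Adversary P → (m : ℕ) → (E : History P → Bool) → History P → ℝ
      Pr A zero    E h = indicator (E h)
      Pr A (suc m) E h =
        𝔼ⁿ (λ v → law (length h) v (start A h v)) λ ω → Pr A m E (extend A h ω)

      noNewlyCovered : (h h′ : History P) → Bool
      noNewlyCovered h h′ = does (coveredSet h′ ⊆? coveredSet h)

      record IsMANET (Vmax : ℝ) (A : Adversary P) : Set where
        field
          distinct     : ∀ {h} → Reachable A h → ∀ {u v} → u ≢ v →
                         ¬ (position A h u ≈ₚ position A h v)
          speed        : ∀ {h ω} → Reachable A h → Possible A h ω → ∀ v →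
                         dist (position A h v) (position A (extend A h ω) v) ≤ Vmax
          sourceActive : ∀ {h} → Reachable A h → length h ≡ t₁ A →
                         active A h (source A) ≡ true

      ActivatedSimultaneouslyWithoutFailures : Adversary P → Set
      ActivatedSimultaneouslyWithoutFailures A =
        ∃[ t₀ ] ∀ {h} → Reachable A h → ∀ v → active A h v ≡ (t₀ ≤ᵇ length h)

      history : Adversary P → (ℕ → Outcome P) → ℕ → History P
      history A ω zero    = []
      history A ω (suc t) = extend A (history A ω t) (ω t)

      IsExecution : Adversary P → (ℕ → Outcome P) → Set
      IsExecution A ω = ∀ t → Possible A (history A ω t) (ω t)

      module _ (A : Adversary P) (d : ℝ) (ω : ℕ → Outcome P) where

        node : ℕ → Fin n → Node P
        node t = start A (history A ω t)

        place : ℕ → Fin n → Point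
        place t = position A (history A ω t)

        activeAt : ℕ → Fin n → Set
        activeAt t v = T (active A (history A ω t) v)

        Target : Fin n → Set
        Target v =
          activeAt (t₁ A) v × dist (place (t₁ A) (source A)) (place (t₁ A) v) ≤ d

        -- At the beginning of slot t.
        Solved : ℕ → Set
        Solved t = ∀ v → Target v → T (covered (node t v))

        Linked : (β t′ : ℕ) → Set
        Linked β t′ = ∃₂ λ p p′ →
          T (informed (node t′ p)) × ¬ T (covered (node t′ p′)) ×
          (∀ t → t′ ℕ.≤ t → t ℕ.< t′ ℕ.+ β → ¬ T (covered (node t p′)) →
            activeAt t p × activeAt t p′ × Neighbours (place t) p p′)

        ConnectedAlong : (α β : ℕ) → Set
        ConnectedAlong α β = ∀ t → t₁ A ℕ.≤ t → ¬ Solved t → ∃[ t′ ]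
          (∃[ x ] t ℕ.≤ x × x ℕ.≤ t ℕ.+ α × t′ ℕ.≤ x × x ℕ.< t′ ℕ.+ β) ×
          Linked β t′

      Connected : (α β : ℕ) (d : ℝ) → Adversary P → Set
      Connected α β d A = ∀ ω → IsExecution A ω → ConnectedAlong A d ω α β

  module _ {n : ℕ} (r Vmax : ℝ) (P : Protocol n) where
    open Protocol P
    open Node

    Conditional : Set
    Conditional = (A : Adversary P) → IsMANET r Vmax A → ∀ {h} → Reachable r A h →
      ∀ v {σ} → status (start A h v) ≡ just σ → ¬ T (covered (start A h v)) →
      ∀ {o} → o ∈supp act σ → proj₁ o ≡ nothing

    -- A node that has failed since it was covered no longer counts: it starts
    -- from scratch, without I.
    Fair : Set
    Fair = (A : Adversary P) → IsMANET r Vmax A → ∀ {h} → Reachable r A h →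
      ∀ u v {σ τ} → status (start A h u) ≡ just σ → status (start A h v) ≡ just τ →
      T (informed (start A h u)) → T (informed (start A h v)) →
      transmitProbability {P = P} σ ≈ transmitProbability {P = P} τ

{-# OPTIONS --safe #-}

-- All nodes lie on a line: the k nodes of the clique, among them the source,
-- near 0, the others near r.  They move so little that the speed bound is met,
-- and as long as some node of the clique is uncovered the two groups are out
-- of reach of each other.  From then on node k sits at r, at distance exactly r
-- from the source, and in every slot the adversary looks at the common
-- transmission probability p: if p ≤ 1/(2M), only the source is left within
-- reach of node k; otherwise the whole clique is, and node k hears something
-- only if exactly one of k independent transmissions occurs.  Either way node k
-- is covered with probability at most 1/(2M), where M is about k / (4 log₂ k),
-- and (1 - 1/(2M)) ^ (2M) ≥ 1/4 turns this into the bound ε ^ c.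
module Submission where

-- The delicate loudness is the threshold itself. At p = 1/(2M) a covered clique makes k/(2M), about
-- 2 log₂ k, transmissions per slot on average, and this logarithmic surplus pushes the chance of at
-- most one transmission down to 1/(2M); hence the logarithm in M. Fairness makes p a single number,
-- and p is fixed by the states before the slot is drawn, so an adversary that cannot foresee random
-- bits may still react to it. The obstacle is to starve node k without breaking connectivity. The
-- source therefore stays exactly at the border of the range of node k in both tactics: the link
-- never breaks, and the rest of the clique can be moved in or out of reach freely from slot to
-- slot. The bound on one slot holds after every history in which exactly the clique is covered, so
-- the bounds for successive slots multiply although everything is adaptive. With L = log₄(1/ε), the
-- time budget and k < 8ℓM give m ≤ 2McL for the number m of slots. All numerical estimates use
-- integer powers and Bernoulli's inequality in place of the exponential function.

open import Defs
open import Algebra.Bundles using (CommutativeRing; Semiring)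
open import Data.Bool.Base using (Bool; true; false; if_then_else_; T; not; _∧_)
open import Data.Bool.Properties using (T?; T-∨; T-∧; T-≡)
open import Data.Fin.Base using (Fin; zero; suc; toℕ; fromℕ<)
open import Data.Fin.Properties using (any?; all?; _≟_; toℕ<n; toℕ-fromℕ<; toℕ-injective; ¬∀⟶∃¬; suc-injective)
open import Data.Fin.Subset using (Subset; ∣_∣; _∈_; _⊆_)
open import Data.Fin.Subset.Properties using (_⊆?_; _∈?_; p⊆q⇒∣p∣≤∣q∣; p⊂q⇒∣p∣<∣q∣)
open import Data.Integer.Base as ℤ using (ℤ; +_; -[1+_]; _⊖_)
open import Data.List.Base using ([]; _∷_; length)
open import Data.Maybe.Base using (Maybe; just; nothing; is-just; fromMaybe)
open import Data.Nat.Base as ℕ using (ℕ; zero; suc; z≤n; s≤s; _≡ᵇ_)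
open import Data.Product.Base using (_×_; _,_; proj₁; proj₂; ∃; ∃₂; ∃-syntax; Σ-syntax)
open import Data.Sum.Base using (_⊎_; inj₁; inj₂; [_,_]′)
open import Data.Unit.Base using (tt)
open import Data.Vec.Base using (tabulate)
open import Data.Vec.Functional as Vector using (Vector)
open import Data.Vec.Properties using (lookup⇒[]=; []=⇒lookup; lookup∘tabulate)
open import Function.Base using (_∘_)
open import Function.Bundles using (Equivalence)
open import Relation.Binary.Bundles using (Poset)
open import Relation.Binary.Definitions using (tri<; tri≈; tri>)
open import Relation.Binary.PropositionalEquality as ≡ using (_≡_; _≢_)
open import Relation.Binary.Structures using (IsDecTotalOrder)
open import Relation.Nullary.Decidable
  using (Dec; yes; no; does; dec-true; dec-false; decidable-stable; toSum; _→-dec_; _×-dec_; ¬?)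
open import Relation.Nullary.Negation using (¬_; contradiction)
import Algebra.Definitions.RawSemiring as RawSemiringDefinitions
import Algebra.Properties.AbelianGroup as AbelianGroupProperties
import Algebra.Properties.CommutativeSemiring.Exp as Exp
import Algebra.Properties.Monoid.Mult.TCOptimised as MonoidMult
import Algebra.Properties.Ring as RingProperties
import Algebra.Properties.Semiring.Mult as Mult
import Algebra.Properties.Semiring.Mult.TCOptimised as SemiringMult
import Algebra.Solver.Ring as RingSolver
import Algebra.Solver.Ring.AlmostCommutativeRing as ACR
import Data.Integer.Properties as ℤ
import Data.Nat.DivMod as ℕ
import Data.Nat.Properties as ℕ
import Data.Nat.Solver as ℕSolver
import Relation.Binary.Reasoning.PartialOrder as PartialOrderReasoning
import Relation.Binary.Reasoning.Setoid as SetoidReasoning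

-- Polynomial identities with integer coefficients; the coefficients of the
-- library's solver must come with a computing equality test, which ℝ lacks.
module IntegerCoefficients {c ℓ} (𝓡 : CommutativeRing c ℓ) where
  open CommutativeRing 𝓡
  open RingProperties ring
  open AbelianGroupProperties +-abelianGroup using (⁻¹-∙-comm; ⁻¹-involutive; ε⁻¹≈ε)
  open SemiringMult semiring using (×1-homo-*)
  open MonoidMult +-monoid using (1+×; ×-homo-+) renaming (_×_ to _·_)
  open SetoidReasoning setoid

  -- The optimised multiple makes `con (+ 0)` and `con (+ 1)` denote `0#` and `1#` by computation.
  -- Larger numerals are spelled out as nested sums in the solver calls, to match the unfolding of
  -- `fromℕ`.
  fromℤ : ℤ → Carrier
  fromℤ (+ n)    = n · 1#
  fromℤ -[1+ n ] = - (suc n · 1#)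

  fromℤ-⊖ : ∀ m n → fromℤ (m ⊖ n) ≈ m · 1# - n · 1#
  fromℤ-⊖ zero    zero    = sym (-‿inverseʳ 0#)
  fromℤ-⊖ zero    (suc n) = sym (+-identityˡ _)
  fromℤ-⊖ (suc m) zero    = sym (trans (+-congˡ ε⁻¹≈ε) (+-identityʳ _))
  fromℤ-⊖ (suc m) (suc n) = begin
    fromℤ (suc m ⊖ suc n)                    ≡⟨ ≡.cong fromℤ (ℤ.[1+m]⊖[1+n]≡m⊖n m n) ⟩
    fromℤ (m ⊖ n)                            ≈⟨ fromℤ-⊖ m n ⟩
    m · 1# - n · 1#                          ≈⟨ +-identityˡ _ ⟨
    0# + (m · 1# - n · 1#)                   ≈⟨ +-congʳ (-‿inverseʳ 1#) ⟨
    (1# - 1#) + (m · 1# - n · 1#)            ≈⟨ +-assoc _ _ _ ⟩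
    1# + (- 1# + (m · 1# - n · 1#))          ≈⟨ +-congˡ (+-assoc _ _ _) ⟨
    1# + ((- 1# + m · 1#) - n · 1#)          ≈⟨ +-congˡ (+-congʳ (+-comm _ _)) ⟩
    1# + ((m · 1# - 1#) - n · 1#)            ≈⟨ +-congˡ (+-assoc _ _ _) ⟩
    1# + (m · 1# + (- 1# - n · 1#))          ≈⟨ +-assoc _ _ _ ⟨
    (1# + m · 1#) + (- 1# - n · 1#)          ≈⟨ +-cong (sym (1+× m 1#)) (⁻¹-∙-comm _ _) ⟩
    suc m · 1# - (1# + n · 1#)               ≈⟨ +-congˡ (-‿cong (1+× n 1#)) ⟨
    suc m · 1# - suc n · 1#                  ∎

  fromℤ-+ : ∀ i j → fromℤ (i ℤ.+ j) ≈ fromℤ i + fromℤ j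
  fromℤ-+ (+ m)    (+ n)    = ×-homo-+ 1# m n
  fromℤ-+ (+ m)    -[1+ n ] = fromℤ-⊖ m (suc n)
  fromℤ-+ -[1+ m ] (+ n)    = trans (fromℤ-⊖ n (suc m)) (+-comm _ _)
  fromℤ-+ -[1+ m ] -[1+ n ] = begin
    - (suc (suc (m ℕ.+ n)) · 1#)     ≡⟨ ≡.cong (λ x → - (suc x · 1#)) (≡.sym (ℕ.+-suc m n)) ⟩
    - ((suc m ℕ.+ suc n) · 1#)       ≈⟨ -‿cong (×-homo-+ 1# (suc m) (suc n)) ⟩
    - (suc m · 1# + suc n · 1#)      ≈⟨ ⁻¹-∙-comm _ _ ⟨
    - (suc m · 1#) - (suc n · 1#)    ∎

  fromℤ-neg : ∀ i → fromℤ (ℤ.- i) ≈ - fromℤ i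
  fromℤ-neg (+ zero)  = sym ε⁻¹≈ε
  fromℤ-neg (+ suc n) = refl
  fromℤ-neg -[1+ n ]  = sym (⁻¹-involutive _)

  fromℤ-* : ∀ i j → fromℤ (i ℤ.* j) ≈ fromℤ i * fromℤ j
  fromℤ-* (+ m)     (+ n)     = trans (reflexive (≡.cong fromℤ (ℤ.+◃n≡+n (m ℕ.* n)))) (×1-homo-* m n)
  fromℤ-* (+ zero)  -[1+ n ]  = sym (zeroˡ _)
  fromℤ-* (+ suc m) -[1+ n ]  = trans (-‿cong (×1-homo-* (suc m) (suc n))) (-‿distribʳ-* _ _)
  fromℤ-* i@(-[1+ m ])  (+ zero)  =
    trans (reflexive (≡.cong fromℤ (ℤ.*-zeroʳ i))) (sym (zeroʳ _))
  fromℤ-* -[1+ m ]  (+ suc n) = trans (-‿cong (×1-homo-* (suc m) (suc n))) (-‿distribˡ-* _ _)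
  fromℤ-* -[1+ m ]  -[1+ n ]  = begin
    (suc m ℕ.* suc n) · 1#              ≈⟨ ×1-homo-* (suc m) (suc n) ⟩
    suc m · 1# * (suc n · 1#)           ≈⟨ ⁻¹-involutive _ ⟨
    - - (suc m · 1# * (suc n · 1#))     ≈⟨ -‿cong (-‿distribˡ-* _ _) ⟩
    - (- (suc m · 1#) * (suc n · 1#))   ≈⟨ -‿distribʳ-* _ _ ⟩
    - (suc m · 1#) * - (suc n · 1#)     ∎

  almostCommutativeRing = ACR.fromCommutativeRing 𝓡

  morphism : ℤ.+-*-rawRing ACR.-Raw-AlmostCommutative⟶ almostCommutativeRing
  morphism = record
    { ⟦_⟧ = fromℤ ; +-homo = fromℤ-+ ; *-homo = fromℤ-* ; -‿homo = fromℤ-neg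
    ; 0-homo = refl ; 1-homo = refl }

  coefficient≟ : ∀ i j → Maybe (fromℤ i ≈ fromℤ j)
  coefficient≟ i j with i ℤ.≟ j
  ... | yes i≡j = just (reflexive (≡.cong fromℤ i≡j))
  ... | no  _   = nothing

  open RingSolver ℤ.+-*-rawRing almostCommutativeRing morphism coefficient≟ public
    using (solve; con; _:+_; _:*_; _:-_; _:=_; :-_)

-- Ordered fields: inequalities, powers, Bernoulli's inequality.

module OrderedField (𝓡 : Reals) where
  open Reals 𝓡
  open CommutativeRing commutativeRing public
    using (+-cong; +-congˡ; +-congʳ; *-cong; *-congˡ; *-congʳ; -‿cong; +-identityˡ; +-identityʳ;
           +-comm; +-assoc; *-comm; *-assoc; *-identityˡ; *-identityʳ; zeroˡ; zeroʳ;
           commutativeSemiring)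
  open IsDecTotalOrder isDecTotalOrder public
    using (antisym; total; module Eq)
    renaming (refl to ≤-refl; reflexive to ≤-reflexive; trans to ≤-trans;
              ≤-respˡ-≈ to ≤-respˡ; ≤-respʳ-≈ to ≤-respʳ)
  open Eq public using () renaming (refl to ≈-refl; sym to ≈-sym; trans to ≈-trans; reflexive to ≈-reflexive)
  open IntegerCoefficients commutativeRing public
    using (solve; con; _:+_; _:*_; _:-_; _:=_; :-_)
  open Mult semiring using (×-homo-+; ×1-homo-*)
  open Exp commutativeSemiring public using (^-congˡ; ^-congʳ; ^-homo-*; ^-assocʳ; ^-distrib-*)

  poset : Poset _ _ _
  poset = record { isPartialOrder = IsDecTotalOrder.isPartialOrder isDecTotalOrder }

  module ≤-Reasoning = PartialOrderReasoning poset

  -- Comparison of reals is decidable here, which licenses the proofs by contradiction below.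
  ≤-stable : ∀ {x y} → ¬ ¬ x ≤ y → x ≤ y
  ≤-stable {x} {y} = decidable-stable (x ≤? y)

  ≰⇒≥ : ∀ {x y} → ¬ x ≤ y → y ≤ x
  ≰⇒≥ {x} {y} x≰y = [ (λ x≤y → contradiction x≤y x≰y) , (λ y≤x → y≤x) ]′ (total x y)

  ≰⇒> : ∀ {x y} → ¬ x ≤ y → y < x
  ≰⇒> x≰y = ≰⇒≥ x≰y , λ y≈x → x≰y (≤-reflexive (≈-sym y≈x))

  <⇒≰ : ∀ {x y} → x < y → ¬ y ≤ x
  <⇒≰ (x≤y , x≉y) y≤x = x≉y (antisym x≤y y≤x)

  <-≤-trans : ∀ {x y z} → x < y → y ≤ z → x < z
  <-≤-trans x<y y≤z = ≰⇒> λ z≤x → <⇒≰ x<y (≤-trans y≤z z≤x)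

  0≤y-x : ∀ {x y} → x ≤ y → 0# ≤ y - x
  0≤y-x {x} {y} x≤y = ≤-respˡ (CommutativeRing.-‿inverseʳ commutativeRing x) (+-monoˡ-≤ (- x) x≤y)

  -- Linear arithmetic: exhibit y - x as a sum of nonnegative terms.
  ≤-by : ∀ {x y e} → 0# ≤ e → y - x ≈ e → x ≤ y
  ≤-by {x} {y} {e} 0≤e y-x≈e = begin
    x            ≈⟨ +-identityˡ x ⟨
    0# + x       ≤⟨ +-monoˡ-≤ x 0≤e ⟩
    e + x        ≈⟨ +-congʳ y-x≈e ⟨
    y - x + x    ≈⟨ solve 2 (λ x y → y :- x :+ x := y) ≈-refl x y ⟩
    y            ∎
    where open ≤-Reasoning

  +-mono-≤ : ∀ {x y u v} → x ≤ y → u ≤ v → x + u ≤ y + v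
  +-mono-≤ {x} {y} {u} {v} x≤y u≤v = begin
    x + u   ≤⟨ +-monoˡ-≤ u x≤y ⟩
    y + u   ≈⟨ +-comm y u ⟩
    u + y   ≤⟨ +-monoˡ-≤ y u≤v ⟩
    v + y   ≈⟨ +-comm v y ⟩
    y + v   ∎
    where open ≤-Reasoning

  +-nonNegative : ∀ {x y} → 0# ≤ x → 0# ≤ y → 0# ≤ x + y
  +-nonNegative 0≤x 0≤y = ≤-respˡ (+-identityˡ 0#) (+-mono-≤ 0≤x 0≤y)

  -‿nonPositive : ∀ {x} → 0# ≤ x → - x ≤ 0#
  -‿nonPositive {x} 0≤x = ≤-by 0≤x (solve 1 (λ x → con (+ 0) :- :- x := x) ≈-refl x)

  x≤x+y : ∀ {x y} → 0# ≤ y → x ≤ x + y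
  x≤x+y {x} 0≤y = ≤-respˡ (+-identityʳ x) (+-mono-≤ ≤-refl 0≤y)

  +-cancelˡ-≤ : ∀ {x y z} → x + y ≤ x + z → y ≤ z
  +-cancelˡ-≤ {x} {y} {z} x+y≤x+z = ≤-by (0≤y-x x+y≤x+z)
    (solve 3 (λ x y z → z :- y := x :+ z :- (x :+ y)) ≈-refl x y z)

  *-monoˡ-≤ : ∀ {z x y} → 0# ≤ z → x ≤ y → z * x ≤ z * y
  *-monoˡ-≤ {z} {x} {y} 0≤z x≤y = ≤-by (*-nonNegative 0≤z (0≤y-x x≤y))
    (solve 3 (λ x y z → z :* y :- z :* x := z :* (y :- x)) ≈-refl x y z)

  *-monoʳ-≤ : ∀ {z x y} → 0# ≤ z → x ≤ y → x * z ≤ y * z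
  *-monoʳ-≤ {z} {x} {y} 0≤z x≤y = ≤-by (*-nonNegative 0≤z (0≤y-x x≤y))
    (solve 3 (λ x y z → y :* z :- x :* z := z :* (y :- x)) ≈-refl x y z)

  *-mono-≤ : ∀ {x y u v} → 0# ≤ x → 0# ≤ v → x ≤ y → u ≤ v → x * u ≤ y * v
  *-mono-≤ 0≤x 0≤v x≤y u≤v = ≤-trans (*-monoˡ-≤ 0≤x u≤v) (*-monoʳ-≤ 0≤v x≤y)

  x²-nonNegative : ∀ x → 0# ≤ x * x
  x²-nonNegative x with total 0# x
  ... | inj₁ 0≤x = *-nonNegative 0≤x 0≤x
  ... | inj₂ x≤0 = ≤-respʳ (solve 1 (λ x → (con (+ 0) :- x) :* (con (+ 0) :- x) := x :* x) ≈-refl x)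
                           (*-nonNegative (0≤y-x x≤0) (0≤y-x x≤0))

  0≤1 : 0# ≤ 1#
  0≤1 = ≤-respʳ (*-identityʳ 1#) (x²-nonNegative 1#)

  0<1 : 0# < 1#
  0<1 = 0≤1 , 0≉1

  ⁻¹-nonNegative : ∀ {x} → 0# < x → 0# ≤ x ⁻¹
  ⁻¹-nonNegative {x} 0<x@(0≤x , 0≉x) = ≤-stable λ ≰ → <⇒≰ 0<1 (begin
    1#         ≈⟨ *-inverseʳ x (0≉x ∘ ≈-sym) ⟨
    x * x ⁻¹   ≤⟨ *-monoˡ-≤ 0≤x (≰⇒≥ ≰) ⟩
    x * 0#     ≈⟨ zeroʳ x ⟩
    0#         ∎)
    where open ≤-Reasoning

  *-cancelʳ-≤ : ∀ {x y z} → 0# < z → x * z ≤ y * z → x ≤ y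
  *-cancelʳ-≤ {x} {y} {z} 0<z xz≤yz = begin
    x               ≈⟨ cancel x ⟩
    x * z * z ⁻¹    ≤⟨ *-monoʳ-≤ (⁻¹-nonNegative 0<z) xz≤yz ⟩
    y * z * z ⁻¹    ≈⟨ cancel y ⟨
    y               ∎
    where
    open ≤-Reasoning
    cancel : ∀ w → w ≈ w * z * z ⁻¹
    cancel w = ≈-sym (≈-trans (*-assoc w z (z ⁻¹))
      (≈-trans (*-congˡ (*-inverseʳ z (proj₂ 0<z ∘ ≈-sym))) (*-identityʳ w)))

  *-cancelˡ-≤ : ∀ {x y z} → 0# < z → z * x ≤ z * y → x ≤ y
  *-cancelˡ-≤ {x} {y} {z} 0<z zx≤zy =
    *-cancelʳ-≤ 0<z (≤-respˡ (*-comm z x) (≤-respʳ (*-comm z y) zx≤zy))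

  *-positive : ∀ {x y} → 0# < x → 0# < y → 0# < x * y
  *-positive {x} 0<x 0<y = ≰⇒> λ xy≤0 →
    <⇒≰ 0<y (*-cancelˡ-≤ 0<x (≤-respʳ (≈-sym (zeroʳ x)) xy≤0))

  *-cancel-positive : ∀ {x y} → 0# ≤ x → 0# < x * y → 0# < y
  *-cancel-positive {x} 0≤x 0<xy = ≰⇒> λ y≤0 →
    <⇒≰ 0<xy (≤-respʳ (zeroʳ x) (*-monoˡ-≤ 0≤x y≤0))

  ⁻¹-positive : ∀ {x} → 0# < x → 0# < x ⁻¹
  ⁻¹-positive {x} 0<x = *-cancel-positive (proj₁ 0<x)
    (<-≤-trans 0<1 (≤-reflexive (≈-sym (*-inverseʳ x (proj₂ 0<x ∘ ≈-sym)))))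

  fromℕ-+ : ∀ m n → fromℕ (m ℕ.+ n) ≈ fromℕ m + fromℕ n
  fromℕ-+ = ×-homo-+ 1#

  fromℕ-* : ∀ m n → fromℕ (m ℕ.* n) ≈ fromℕ m * fromℕ n
  fromℕ-* = ×1-homo-*

  fromℕ-nonNegative : ∀ n → 0# ≤ fromℕ n
  fromℕ-nonNegative zero    = ≤-refl
  fromℕ-nonNegative (suc n) = +-nonNegative 0≤1 (fromℕ-nonNegative n)

  fromℕ-mono-≤ : ∀ {m n} → m ℕ.≤ n → fromℕ m ≤ fromℕ n
  fromℕ-mono-≤ {n = n} z≤n = fromℕ-nonNegative n
  fromℕ-mono-≤ (s≤s m≤n)   = +-mono-≤ ≤-refl (fromℕ-mono-≤ m≤n)

  fromℕ-1 : fromℕ 1 ≈ 1#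
  fromℕ-1 = +-identityʳ 1#

  fromℕ-cancel-≤ : ∀ {m n} → fromℕ m ≤ fromℕ n → m ℕ.≤ n
  fromℕ-cancel-≤ {m} {n} fm≤fn with m ℕ.≤? n
  ... | yes m≤n = m≤n
  ... | no  m≰n = contradiction
    (≤-by (0≤y-x (≤-trans (fromℕ-mono-≤ (ℕ.≰⇒> m≰n)) fm≤fn))
      (solve 1 (λ x → con (+ 0) :- con (+ 1) := x :- (con (+ 1) :+ x)) ≈-refl (fromℕ n)))
    (<⇒≰ 0<1)

  fromℕ-positive : ∀ {n} → 0 ℕ.< n → 0# < fromℕ n
  fromℕ-positive 0<n = <-≤-trans 0<1 (≤-respˡ fromℕ-1 (fromℕ-mono-≤ 0<n))

  *-inverse-fromℕ : ∀ {n} → 0 ℕ.< n → fromℕ n * fromℕ n ⁻¹ ≈ 1#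
  *-inverse-fromℕ {n} 0<n = *-inverseʳ (fromℕ n) (proj₂ (fromℕ-positive 0<n) ∘ ≈-sym)

  ^-nonNegative : ∀ {x} n → 0# ≤ x → 0# ≤ x ^ n
  ^-nonNegative zero    0≤x = 0≤1
  ^-nonNegative (suc n) 0≤x = *-nonNegative 0≤x (^-nonNegative n 0≤x)

  ^-positive : ∀ {x} n → 0# < x → 0# < x ^ n
  ^-positive zero    0<x = 0<1
  ^-positive (suc n) 0<x = *-positive 0<x (^-positive n 0<x)

  ^-monoˡ-≤ : ∀ {x y} n → 0# ≤ x → x ≤ y → x ^ n ≤ y ^ n
  ^-monoˡ-≤ zero    0≤x x≤y = ≤-refl
  ^-monoˡ-≤ (suc n) 0≤x x≤y =
    *-mono-≤ 0≤x (^-nonNegative n (≤-trans 0≤x x≤y)) x≤y (^-monoˡ-≤ n 0≤x x≤y)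

  1^n≈1 : ∀ n → 1# ^ n ≈ 1#
  1^n≈1 zero    = ≈-refl
  1^n≈1 (suc n) = ≈-trans (*-identityˡ _) (1^n≈1 n)

  1≤x^n : ∀ {x} n → 1# ≤ x → 1# ≤ x ^ n
  1≤x^n n 1≤x = ≤-respˡ (1^n≈1 n) (^-monoˡ-≤ n 0≤1 1≤x)

  x^n≤1 : ∀ {x} n → 0# ≤ x → x ≤ 1# → x ^ n ≤ 1#
  x^n≤1 n 0≤x x≤1 = ≤-respʳ (1^n≈1 n) (^-monoˡ-≤ n 0≤x x≤1)

  ^-monoʳ-≤ : ∀ {x m n} → 1# ≤ x → m ℕ.≤ n → x ^ m ≤ x ^ n
  ^-monoʳ-≤ {n = n} 1≤x z≤n = 1≤x^n n 1≤x
  ^-monoʳ-≤ 1≤x (s≤s m≤n)   = *-monoˡ-≤ (≤-trans 0≤1 1≤x) (^-monoʳ-≤ 1≤x m≤n)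

  ^-antiʳ-≤ : ∀ {x m n} → 0# ≤ x → x ≤ 1# → m ℕ.≤ n → x ^ n ≤ x ^ m
  ^-antiʳ-≤ {n = n} 0≤x x≤1 z≤n = x^n≤1 n 0≤x x≤1
  ^-antiʳ-≤ 0≤x x≤1 (s≤s m≤n)   = *-monoˡ-≤ 0≤x (^-antiʳ-≤ 0≤x x≤1 m≤n)

  ^-cancelʳ-≤ : ∀ {x m n} → 1# < x → x ^ m ≤ x ^ n → m ℕ.≤ n
  ^-cancelʳ-≤ {x} {m} {n} 1<x x^m≤x^n with m ℕ.≤? n
  ... | yes m≤n = m≤n
  ... | no  m≰n = contradiction (*-cancelʳ-≤ (^-positive n (<-≤-trans 0<1 1≤x)) (begin
    x * x ^ n    ≤⟨ ^-monoʳ-≤ 1≤x (ℕ.≰⇒> m≰n) ⟩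
    x ^ m        ≤⟨ x^m≤x^n ⟩
    x ^ n        ≈⟨ *-identityˡ _ ⟨
    1# * x ^ n   ∎)) (<⇒≰ 1<x)
    where
    open ≤-Reasoning
    1≤x = proj₁ 1<x

  ^-cancelˡ-≤ : ∀ {x y} n → 0 ℕ.< n → 0# < y → x ^ n ≤ y ^ n → x ≤ y
  ^-cancelˡ-≤ {x} {y} (suc n) _ 0<y x^n≤y^n = ≤-stable λ x≰y →
    let y≤x = ≰⇒≥ x≰y in x≰y (*-cancelʳ-≤ (^-positive n 0<y) (begin
      x * y ^ n   ≤⟨ *-monoˡ-≤ (≤-trans (proj₁ 0<y) y≤x) (^-monoˡ-≤ n (proj₁ 0<y) y≤x) ⟩
      x * x ^ n   ≤⟨ x^n≤y^n ⟩
      y * y ^ n   ∎))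
    where open ≤-Reasoning

  bernoulli : ∀ {x} n → 0# ≤ 1# + x → 1# + fromℕ n * x ≤ (1# + x) ^ n
  bernoulli {x} zero    _     = ≤-reflexive (≈-trans (+-congˡ (zeroˡ x)) (+-identityʳ 1#))
  bernoulli {x} (suc n) 0≤1+x = ≤-trans
    (≤-by (*-nonNegative (fromℕ-nonNegative n) (x²-nonNegative x))
      (solve 2 (λ N x → (con (+ 1) :+ x) :* (con (+ 1) :+ N :* x)
                          :- (con (+ 1) :+ (con (+ 1) :+ N) :* x)
                        := N :* (x :* x)) ≈-refl (fromℕ n) x))
    (*-monoˡ-≤ 0≤1+x (bernoulli n 0≤1+x))

  fromℕ-^ : ∀ m n → fromℕ (m ℕ.^ n) ≈ fromℕ m ^ n
  fromℕ-^ m zero    = fromℕ-1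
  fromℕ-^ m (suc n) = ≈-trans (fromℕ-* m (m ℕ.^ n)) (*-congˡ (fromℕ-^ m n))

-- Integer parameters: the rounded logarithm ℓ and the threshold parameter M.

4[4+j]≤2^[4+j] : ∀ j → 4 ℕ.* (4 ℕ.+ j) ℕ.≤ 2 ℕ.^ (4 ℕ.+ j)
4[4+j]≤2^[4+j] zero    = ℕ.≤-refl
4[4+j]≤2^[4+j] (suc j) = begin
  4 ℕ.* (5 ℕ.+ j)                        ≡⟨ ℕ.*-suc 4 (4 ℕ.+ j) ⟩
  4 ℕ.+ 4 ℕ.* (4 ℕ.+ j)                  ≤⟨ ℕ.+-mono-≤ (ℕ.≤-trans (ℕ.m≤m*n 4 (4 ℕ.+ j)) ih) ih ⟩
  2 ℕ.^ (4 ℕ.+ j) ℕ.+ 2 ℕ.^ (4 ℕ.+ j)    ≡⟨ ≡.cong (2 ℕ.^ (4 ℕ.+ j) ℕ.+_) (ℕ.+-identityʳ _) ⟨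
  2 ℕ.^ (5 ℕ.+ j)                        ∎
  where
  open ℕ.≤-Reasoning
  ih = 4[4+j]≤2^[4+j] j

-- The integer part of log₂ k. It replaces the real logarithm, which enters the time budget through
-- ℓ ≤ log₂ k.
binaryLogarithm : ∀ k → 1 ℕ.≤ k → ∃[ ℓ ] (2 ℕ.^ ℓ ℕ.≤ k × k ℕ.< 2 ℕ.^ suc ℓ)
binaryLogarithm 1 _ = 0 , ℕ.≤-refl , ℕ.≤-refl
binaryLogarithm (suc (suc k)) _ with binaryLogarithm (suc k) (s≤s z≤n)
... | ℓ , lower , upper with suc (suc k) ℕ.<? 2 ℕ.^ suc ℓ
...   | yes k<    = ℓ , ℕ.m≤n⇒m≤1+n lower , k<
...   | no  k≮    = suc ℓ , ℕ.≮⇒≥ k≮ , ℕ.≤-<-trans upper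
                    (ℕ.^-monoʳ-< 2 (s≤s (s≤s z≤n)) {suc ℓ} ℕ.≤-refl)

-- The adversary's threshold is 1/(2M); this M gives room both for the
-- Chernoff bound (4Mℓ≤k and 4M≤2^ℓ) and for the time budget (k<8ℓM).
record Threshold (k : ℕ) : Set where
  field
    ℓ M : ℕ
    0<ℓ       : 0 ℕ.< ℓ
    0<M       : 0 ℕ.< M
    2^ℓ≤k     : 2 ℕ.^ ℓ ℕ.≤ k
    k<2^1+ℓ   : k ℕ.< 2 ℕ.^ suc ℓ
    4Mℓ≤k     : (4 ℕ.* M) ℕ.* ℓ ℕ.≤ k
    4M≤2^ℓ    : 4 ℕ.* M ℕ.≤ 2 ℕ.^ ℓ
    k<8ℓM     : k ℕ.< 8 ℕ.* (ℓ ℕ.* M)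

threshold : ∀ {k} → 45 ℕ.≤ k → Threshold k
threshold {k} 45≤k with binaryLogarithm k (ℕ.≤-trans (s≤s z≤n) 45≤k)
... | ℓ , 2^ℓ≤k , k<2^1+ℓ = record
  { ℓ = ℓ ; M = M ; 0<ℓ = ℕ.≤-trans (s≤s z≤n) 4≤ℓ ; 0<M = 0<M
  ; 2^ℓ≤k = 2^ℓ≤k ; k<2^1+ℓ = k<2^1+ℓ ; 4Mℓ≤k = 4Mℓ≤k ; 4M≤2^ℓ = 4M≤2^ℓ ; k<8ℓM = k<8ℓM }
  where
  open ℕ.≤-Reasoning
  open ℕSolver.+-*-Solver

  -- From 4 on, 4ℓ ≤ 2^ℓ, with equality at 4; together with 2^ℓ ≤ k this makes the quotient M
  -- positive.
  4≤ℓ : 4 ℕ.≤ ℓ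
  4≤ℓ = ℕ.≮⇒≥ λ ℓ<4 → ℕ.<⇒≱ k<2^1+ℓ (begin
    2 ℕ.^ suc ℓ   ≤⟨ ℕ.^-monoʳ-≤ 2 ℓ<4 ⟩
    16            ≤⟨ ℕ.m≤m+n 16 29 ⟩
    45            ≤⟨ 45≤k ⟩
    k             ∎)

  instance
    4ℓ≢0 : ℕ.NonZero (4 ℕ.* ℓ)
    4ℓ≢0 = ℕ.>-nonZero (ℕ.≤-trans (s≤s z≤n) (ℕ.*-monoʳ-≤ 4 4≤ℓ))
    ℓ≢0 : ℕ.NonZero ℓ
    ℓ≢0 = ℕ.>-nonZero (ℕ.≤-trans (s≤s z≤n) 4≤ℓ)

  -- The largest M with 4Mℓ ≤ k. As k/(4ℓ) is at least 1, rounding down loses less than a factor 2,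
  -- whence k < 8ℓM.
  M = k ℕ./ (4 ℕ.* ℓ)

  4ℓ≤2^ℓ : 4 ℕ.* ℓ ℕ.≤ 2 ℕ.^ ℓ
  4ℓ≤2^ℓ = ≡.subst (λ ℓ → 4 ℕ.* ℓ ℕ.≤ 2 ℕ.^ ℓ) (ℕ.m+[n∸m]≡n 4≤ℓ) (4[4+j]≤2^[4+j] (ℓ ℕ.∸ 4))

  0<M : 0 ℕ.< M
  0<M = ℕ.m≥n⇒m/n>0 (ℕ.≤-trans 4ℓ≤2^ℓ 2^ℓ≤k)

  4Mℓ≤k : (4 ℕ.* M) ℕ.* ℓ ℕ.≤ k
  4Mℓ≤k = begin
    (4 ℕ.* M) ℕ.* ℓ   ≡⟨ solve 2 (λ M ℓ → con 4 :* M :* ℓ := M :* (con 4 :* ℓ)) ≡.refl M ℓ ⟩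
    M ℕ.* (4 ℕ.* ℓ)   ≤⟨ ℕ.m/n*n≤m k (4 ℕ.* ℓ) ⟩
    k                 ∎

  4M≤2^ℓ : 4 ℕ.* M ℕ.≤ 2 ℕ.^ ℓ
  4M≤2^ℓ = ℕ.*-cancelʳ-≤ (4 ℕ.* M) (2 ℕ.^ ℓ) ℓ (begin
    (4 ℕ.* M) ℕ.* ℓ   ≤⟨ 4Mℓ≤k ⟩
    k                 ≤⟨ ℕ.<⇒≤ k<2^1+ℓ ⟩
    2 ℕ.* 2 ℕ.^ ℓ     ≡⟨ ℕ.*-comm 2 (2 ℕ.^ ℓ) ⟩
    2 ℕ.^ ℓ ℕ.* 2     ≤⟨ ℕ.*-monoʳ-≤ (2 ℕ.^ ℓ) (ℕ.≤-trans (s≤s (s≤s z≤n)) 4≤ℓ) ⟩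
    2 ℕ.^ ℓ ℕ.* ℓ     ∎)

  k<8ℓM : k ℕ.< 8 ℕ.* (ℓ ℕ.* M)
  k<8ℓM = begin-strict
    k                                         ≡⟨ ℕ.m≡m%n+[m/n]*n k (4 ℕ.* ℓ) ⟩
    k ℕ.% (4 ℕ.* ℓ) ℕ.+ M ℕ.* (4 ℕ.* ℓ)       <⟨ ℕ.+-monoˡ-< _ (ℕ.m%n<n k (4 ℕ.* ℓ)) ⟩
    4 ℕ.* ℓ ℕ.+ M ℕ.* (4 ℕ.* ℓ)               ≤⟨ ℕ.+-monoˡ-≤ _ (ℕ.m≤n*m (4 ℕ.* ℓ) M {{ℕ.>-nonZero 0<M}}) ⟩
    M ℕ.* (4 ℕ.* ℓ) ℕ.+ M ℕ.* (4 ℕ.* ℓ)       ≡⟨ solve 2 (λ M ℓ → M :* (con 4 :* ℓ) :+ M :* (con 4 :* ℓ)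
                                                                  := con 8 :* (ℓ :* M)) ≡.refl M ℓ ⟩
    8 ℕ.* (ℓ ℕ.* M)                           ∎

-- Logarithms, and the two numerical bounds on which M rests.

module Estimates (𝓡 : Reals) where
  open Reals 𝓡
  open OrderedField 𝓡

  *-/-cancelʳ : ∀ x {z} → 0# < z → x * z / z ≈ x
  *-/-cancelʳ x {z} 0<z = ≈-trans (*-assoc x z (z ⁻¹))
    (≈-trans (*-congˡ (*-inverseʳ z (proj₂ 0<z ∘ ≈-sym))) (*-identityʳ x))

  /-*-cancelʳ : ∀ x {z} → 0# < z → x / z * z ≈ x
  /-*-cancelʳ x {z} 0<z =
    ≈-trans (solve 3 (λ x z w → x :* w :* z := x :* z :* w) ≈-refl x z (z ⁻¹)) (*-/-cancelʳ x 0<z)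

  ≤*⇒/≤ : ∀ {x y z} → 0# < z → x ≤ y * z → x / z ≤ y
  ≤*⇒/≤ {x} {y} 0<z x≤yz = *-cancelʳ-≤ 0<z (≤-respˡ (≈-sym (/-*-cancelʳ x 0<z)) x≤yz)

  *≤⇒≤/ : ∀ {x y z} → 0# < z → x * z ≤ y → x ≤ y / z
  *≤⇒≤/ {x} {y} 0<z xz≤y = *-cancelʳ-≤ 0<z (≤-respʳ (≈-sym (/-*-cancelʳ y 0<z)) xz≤y)

  ≤/⇒*≤ : ∀ {x y z} → 0# < z → x ≤ y / z → x * z ≤ y
  ≤/⇒*≤ {x} {y} 0<z x≤y/z = ≤-respʳ (/-*-cancelʳ y 0<z) (*-monoʳ-≤ (proj₁ 0<z) x≤y/z)

  module _ {b x : ℝ} (1<b : 1# < b) (1≤x : 1# ≤ x) where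

    LogFraction : ℝ → Set
    LogFraction y = ∃₂ λ p q → 0 ℕ.< q × b ^ p ≤ x ^ q × y ≈ fromℕ p / fromℕ q

    -- Cross-multiplication in the exponents: b^(pv) ≤ x^(qv) ≤ b^(uq) forces pv ≤ uq, as b > 1.
    logFraction-bound : ∀ u v → 0 ℕ.< v → x ^ v ≤ b ^ u → IsUpperBound LogFraction (fromℕ u / fromℕ v)
    logFraction-bound u v 0<v x^v≤b^u y (p , q , 0<q , b^p≤x^q , y≈p/q) =
      ≤-respˡ (≈-sym y≈p/q) (≤*⇒/≤ (fromℕ-positive 0<q) (begin
        fromℕ p                       ≤⟨ *≤⇒≤/ (fromℕ-positive 0<v) pv≤uq ⟩
        fromℕ u * fromℕ q / fromℕ v   ≈⟨ solve 3 (λ u q w → u :* q :* w := u :* w :* q) ≈-refl _ _ _ ⟩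
        fromℕ u / fromℕ v * fromℕ q   ∎))
      where
      open ≤-Reasoning
      0≤b = ≤-trans 0≤1 (proj₁ 1<b)
      pv≤uq : fromℕ p * fromℕ v ≤ fromℕ u * fromℕ q
      pv≤uq = begin
        fromℕ p * fromℕ v   ≈⟨ fromℕ-* p v ⟨
        fromℕ (p ℕ.* v)     ≤⟨ fromℕ-mono-≤ (^-cancelʳ-≤ {m = p ℕ.* v} {n = u ℕ.* q} 1<b (begin
          b ^ (p ℕ.* v)       ≈⟨ ^-assocʳ b p v ⟨
          (b ^ p) ^ v         ≤⟨ ^-monoˡ-≤ v (^-nonNegative p 0≤b) b^p≤x^q ⟩
          (x ^ q) ^ v         ≈⟨ ^-assocʳ x q v ⟩
          x ^ (q ℕ.* v)       ≈⟨ ^-congʳ x (ℕ.*-comm q v) ⟩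
          x ^ (v ℕ.* q)       ≈⟨ ^-assocʳ x v q ⟨
          (x ^ v) ^ q         ≤⟨ ^-monoˡ-≤ q (^-nonNegative v (≤-trans 0≤1 1≤x)) x^v≤b^u ⟩
          (b ^ u) ^ q         ≈⟨ ^-assocʳ b u q ⟩
          b ^ (u ℕ.* q)       ∎)) ⟩
        fromℕ (u ℕ.* q)     ≈⟨ fromℕ-* u q ⟩
        fromℕ u * fromℕ q   ∎

    -- `sup` has meaning only for nonempty sets that are bounded above. The fraction 0/1 is a member
    -- because x ≥ 1, and u/v serves as the bound.
    log-isSupremum : ∀ u v → 0 ℕ.< v → x ^ v ≤ b ^ u → IsSupremum LogFraction (log b x)
    log-isSupremum u v 0<v x^v≤b^u = sup-isSupremum LogFraction
      (_ , 0 , 1 , s≤s z≤n , 1≤x^n 1 1≤x , ≈-refl)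
      (_ , logFraction-bound u v 0<v x^v≤b^u)

    log-≤ : ∀ u v → 0 ℕ.< v → x ^ v ≤ b ^ u → log b x ≤ fromℕ u / fromℕ v
    log-≤ u v 0<v x^v≤b^u =
      proj₂ (log-isSupremum u v 0<v x^v≤b^u) _ (logFraction-bound u v 0<v x^v≤b^u)

    ≤-log : ∀ p q u v → 0 ℕ.< q → b ^ p ≤ x ^ q → 0 ℕ.< v → x ^ v ≤ b ^ u →
            fromℕ p / fromℕ q ≤ log b x
    ≤-log p q u v 0<q b^p≤x^q 0<v x^v≤b^u =
      proj₁ (log-isSupremum u v 0<v x^v≤b^u) _ (p , q , 0<q , b^p≤x^q , ≈-refl)

  1<fromℕ : ∀ {n} → 2 ℕ.≤ n → 1# < fromℕ n
  1<fromℕ {n} 2≤n = ≰⇒> λ n≤1 →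
    ℕ.<⇒≱ 2≤n (fromℕ-cancel-≤ {n} {1} (≤-respʳ (≈-sym fromℕ-1) n≤1))

  half : ℝ
  half = fromℕ 2 ⁻¹

  half-nonNegative : 0# ≤ half
  half-nonNegative = ⁻¹-nonNegative (fromℕ-positive {2} (s≤s z≤n))

  half+half : half + half ≈ 1#
  half+half = ≈-trans
    (solve 1 (λ h → h :+ h := (con (+ 1) :+ (con (+ 1) :+ con (+ 0))) :* h) ≈-refl half)
    (*-inverse-fromℕ {2} (s≤s z≤n))

  half≤1 : half ≤ 1#
  half≤1 = ≤-respʳ half+half (≤-respˡ (+-identityʳ half) (+-mono-≤ ≤-refl half-nonNegative))

  1-half*p-nonNegative : ∀ {p} → p ≤ 1# → 0# ≤ 1# - half * p
  1-half*p-nonNegative p≤1 = 0≤y-x (≤-respʳ (*-identityʳ 1#) (*-mono-≤ half-nonNegative 0≤1 half≤1 p≤1))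

  module _ {M : ℕ} (0<M : 0 ℕ.< M) where

    private
      -- As a sum, so that a power with exponent N splits into two equal factors.
      N = M ℕ.+ M
      0<N : 0 ℕ.< N
      0<N = ℕ.≤-trans 0<M (ℕ.m≤m+n M M)

    q₀ : ℝ
    q₀ = fromℕ N ⁻¹

    0≤q₀ : 0# ≤ q₀
    0≤q₀ = ⁻¹-nonNegative (fromℕ-positive 0<N)

    private
      Nq₀≈1 : fromℕ N * q₀ ≈ 1#
      Nq₀≈1 = *-inverse-fromℕ 0<N

      2q₀≤1 : q₀ + q₀ ≤ 1#
      2q₀≤1 = begin
        q₀ + q₀          ≈⟨ solve 1 (λ q → q :+ q := (con (+ 1) :+ (con (+ 1) :+ con (+ 0))) :* q) ≈-refl q₀ ⟩
        fromℕ 2 * q₀     ≤⟨ *-monoʳ-≤ 0≤q₀ (fromℕ-mono-≤ (ℕ.+-mono-≤ 0<M 0<M)) ⟩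
        fromℕ N * q₀     ≈⟨ Nq₀≈1 ⟩
        1#               ∎
        where open ≤-Reasoning

    q₀≤1-q₀ : q₀ ≤ 1# - q₀
    q₀≤1-q₀ = ≤-by (0≤y-x 2q₀≤1)
      (solve 1 (λ q → con (+ 1) :- q :- q := con (+ 1) :- (q :+ q)) ≈-refl q₀)

    1-q₀-nonNegative : 0# ≤ 1# - q₀
    1-q₀-nonNegative = ≤-trans 0≤q₀ q₀≤1-q₀

    1-q₀-positive : 0# < 1# - q₀
    1-q₀-positive = <-≤-trans (⁻¹-positive (fromℕ-positive 0<N)) q₀≤1-q₀

    -- Bernoulli with exponent M gives (1 - q₀)^M ≥ 1 - M q₀ = 1/2, and squaring gives 1/4. Applied
    -- directly with exponent 2M it would only give 0.
    1≤4[1-q₀]^N : 1# ≤ fromℕ 4 * (1# - q₀) ^ N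
    1≤4[1-q₀]^N = begin
      1#                           ≈⟨ *-identityˡ 1# ⟨
      1# * 1#                      ≤⟨ *-mono-≤ 0≤1 (≤-trans 0≤1 1≤2h) 1≤2h 1≤2h ⟩
      (h + h) * (h + h)            ≈⟨ solve 1 (λ h → (h :+ h) :* (h :+ h)
                                        := (con (+ 1) :+ (con (+ 1) :+ (con (+ 1) :+ (con (+ 1) :+ con (+ 0))))) :* (h :* h)) ≈-refl h ⟩
      fromℕ 4 * (h * h)            ≈⟨ *-congˡ (^-homo-* (1# - q₀) M M) ⟨
      fromℕ 4 * (1# - q₀) ^ N      ∎
      where
      open ≤-Reasoning
      h = (1# - q₀) ^ M
      1≤2h : 1# ≤ h + h
      1≤2h = begin
        1#                                     ≈⟨ solve 0 (con (+ 1) := con (+ 1) :+ con (+ 1) :- con (+ 1)) ≈-refl ⟩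
        1# + 1# - 1#                           ≈⟨ +-congˡ (-‿cong (≈-trans (*-congʳ (≈-sym (fromℕ-+ M M))) Nq₀≈1)) ⟨
        1# + 1# - (fromℕ M + fromℕ M) * q₀     ≈⟨ solve 2 (λ m q → con (+ 1) :+ con (+ 1) :- (m :+ m) :* q
                                                    := (con (+ 1) :+ m :* (:- q)) :+ (con (+ 1) :+ m :* (:- q))) ≈-refl (fromℕ M) q₀ ⟩
        (1# + fromℕ M * (- q₀)) + (1# + fromℕ M * (- q₀))
                                               ≤⟨ +-mono-≤ (bernoulli M 1-q₀-nonNegative) (bernoulli M 1-q₀-nonNegative) ⟩
        h + h                                  ∎

    -- With u = q₀/2 = 1/(4M), each block of 4M factors 1 - u is at most 1/2, and k contains ℓ such
    -- blocks. So the power is at most 2^(-ℓ) ≤ 1/(4M), and twice this is q₀.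
    silence-bound : ∀ {ℓ k p} → (4 ℕ.* M) ℕ.* ℓ ℕ.≤ k → 4 ℕ.* M ℕ.≤ 2 ℕ.^ ℓ →
      q₀ ≤ p → p ≤ 1# → fromℕ 2 * (1# - half * p) ^ k ≤ q₀
    silence-bound {ℓ} {k} {p} 4Mℓ≤k 4M≤2^ℓ q₀≤p p≤1 = *-cancelˡ-≤ (fromℕ-positive 0<N) (begin
      fromℕ N * (fromℕ 2 * (1# - half * p) ^ k)
        ≤⟨ *-monoˡ-≤ (fromℕ-nonNegative N) (*-monoˡ-≤ (fromℕ-nonNegative 2)
             (^-monoˡ-≤ k (1-half*p-nonNegative p≤1)
               (≤-by (*-nonNegative half-nonNegative (0≤y-x q₀≤p))
                 (solve 3 (λ h q p → con (+ 1) :- h :* q :- (con (+ 1) :- h :* p) := h :* (p :- q))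
                   ≈-refl half q₀ p)))) ⟩
      fromℕ N * (fromℕ 2 * W ^ k)
        ≤⟨ *-monoˡ-≤ (fromℕ-nonNegative N) (*-monoˡ-≤ (fromℕ-nonNegative 2) (^-antiʳ-≤ 0≤W W≤1 4Mℓ≤k)) ⟩
      fromℕ N * (fromℕ 2 * W ^ (4M ℕ.* ℓ))
        ≈⟨ *-assoc _ _ _ ⟨
      fromℕ N * fromℕ 2 * W ^ (4M ℕ.* ℓ)
        ≈⟨ *-cong (≈-trans (≈-sym (fromℕ-* N 2)) (≈-reflexive (≡.cong fromℕ N*2≡4M))) (≈-sym (^-assocʳ W 4M ℓ)) ⟩
      fromℕ 4M * (W ^ 4M) ^ ℓ
        ≤⟨ *-monoʳ-≤ (^-nonNegative ℓ (^-nonNegative 4M 0≤W)) (fromℕ-mono-≤ 4M≤2^ℓ) ⟩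
      fromℕ (2 ℕ.^ ℓ) * (W ^ 4M) ^ ℓ
        ≈⟨ *-congʳ (fromℕ-^ 2 ℓ) ⟩
      fromℕ 2 ^ ℓ * (W ^ 4M) ^ ℓ
        ≈⟨ ^-distrib-* _ _ ℓ ⟨
      (fromℕ 2 * W ^ 4M) ^ ℓ
        ≤⟨ x^n≤1 ℓ (*-nonNegative (fromℕ-nonNegative 2) (^-nonNegative 4M 0≤W)) 2W^4M≤1 ⟩
      1#
        ≈⟨ Nq₀≈1 ⟨
      fromℕ N * q₀ ∎)
      where
      open ≤-Reasoning
      4M = 4 ℕ.* M
      u = half * q₀
      W = 1# - u

      N*2≡4M : N ℕ.* 2 ≡ 4M
      N*2≡4M = ℕ-solve 1 (λ M → (M ℕ:+ M) ℕ:* ℕcon 2 ℕ:= ℕcon 4 ℕ:* M) ≡.refl M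
        where open ℕSolver.+-*-Solver renaming
                (solve to ℕ-solve; _:+_ to _ℕ:+_; _:*_ to _ℕ:*_; _:=_ to _ℕ:=_; con to ℕcon)

      4Mu≈1 : fromℕ 4M * u ≈ 1#
      4Mu≈1 = begin-equality
        fromℕ 4M * u                ≡⟨ ≡.cong (λ x → fromℕ x * u) N*2≡4M ⟨
        fromℕ (N ℕ.* 2) * u         ≈⟨ *-congʳ (fromℕ-* N 2) ⟩
        fromℕ N * fromℕ 2 * (half * q₀)
          ≈⟨ solve 4 (λ n t h q → n :* t :* (h :* q) := (n :* q) :* (t :* h)) ≈-refl _ _ _ _ ⟩
        fromℕ N * q₀ * (fromℕ 2 * half)
          ≈⟨ *-cong Nq₀≈1 (*-inverse-fromℕ {2} (s≤s z≤n)) ⟩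
        1# * 1#                     ≈⟨ *-identityˡ 1# ⟩
        1#                          ∎

      0≤u : 0# ≤ u
      0≤u = *-nonNegative half-nonNegative 0≤q₀

      0≤W : 0# ≤ W
      0≤W = ≤-trans (1-half*p-nonNegative p≤1) (≤-by (*-nonNegative half-nonNegative (0≤y-x q₀≤p))
        (solve 3 (λ h q p → con (+ 1) :- h :* q :- (con (+ 1) :- h :* p) := h :* (p :- q))
          ≈-refl half q₀ p))

      W≤1 : W ≤ 1#
      W≤1 = ≤-by 0≤u (solve 1 (λ u → con (+ 1) :- (con (+ 1) :- u) := u) ≈-refl u)

      -- Here 2 = 1 + 4M u ≤ (1 + u)^(4M) by Bernoulli, and (1 + u)(1 - u) ≤ 1.
      2W^4M≤1 : fromℕ 2 * W ^ 4M ≤ 1#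
      2W^4M≤1 = begin
        fromℕ 2 * W ^ 4M
          ≈⟨ *-congʳ (+-congˡ (≈-trans fromℕ-1 (≈-sym 4Mu≈1))) ⟩
        (1# + fromℕ 4M * u) * W ^ 4M
          ≤⟨ *-monoʳ-≤ (^-nonNegative 4M 0≤W) (bernoulli 4M (+-nonNegative 0≤1 0≤u)) ⟩
        (1# + u) ^ 4M * W ^ 4M
          ≈⟨ ^-distrib-* _ _ 4M ⟨
        ((1# + u) * W) ^ 4M
          ≤⟨ x^n≤1 4M (*-nonNegative (+-nonNegative 0≤1 0≤u) 0≤W)
               (≤-by (x²-nonNegative u) (solve 1 (λ u → con (+ 1) :- (con (+ 1) :+ u) :* (con (+ 1) :- u) := u :* u) ≈-refl u)) ⟩
        1# ∎

    -- Both sides are raised to the power N = 2M and multiplied by 4^m, so that no roots occur. The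
    -- right side then is at least 1 by the bound 1/4 on (1 - q₀)^N, and the left side is at most 1
    -- because m ≤ N c log₄(1/ε), here in the form 4^m ≤ x^(Nc).
    survival-bound : ∀ {ε T k ℓ c m} → 0# < ε → ε < 1# →
      0 ℕ.< ℓ → 2 ℕ.^ ℓ ℕ.≤ k → k ℕ.< 2 ℕ.^ suc ℓ → k ℕ.< 8 ℕ.* (ℓ ℕ.* M) → 0 ℕ.< c →
      T ≤ (fromℕ k * log (fromℕ 4) (1# / ε)) / (fromℕ 4 * log (fromℕ 2) (fromℕ k)) →
      fromℕ m ≤ fromℕ c * T → ε ^ c ≤ (1# - q₀) ^ m
    survival-bound {ε} {T} {k} {ℓ} {c} {m} 0<ε ε<1 0<ℓ 2^ℓ≤k k<2^1+ℓ k<8ℓM 0<c T≤ m≤cT =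
      ^-cancelˡ-≤ N 0<N (^-positive m 1-q₀-positive) (*-cancelˡ-≤ (^-positive m 0<4) (begin
        fromℕ 4 ^ m * (ε ^ c) ^ N            ≈⟨ *-congˡ (≈-trans (^-assocʳ ε c N) (^-congʳ ε (ℕ.*-comm c N))) ⟩
        fromℕ 4 ^ m * ε ^ (N ℕ.* c)          ≤⟨ *-monoʳ-≤ (^-nonNegative (N ℕ.* c) (proj₁ 0<ε)) 4^m≤x^Nc ⟩
        x ^ (N ℕ.* c) * ε ^ (N ℕ.* c)        ≈⟨ ^-distrib-* x ε (N ℕ.* c) ⟨
        (x * ε) ^ (N ℕ.* c)                  ≈⟨ ^-congˡ (N ℕ.* c) (/-*-cancelʳ 1# 0<ε) ⟩
        1# ^ (N ℕ.* c)                       ≈⟨ 1^n≈1 (N ℕ.* c) ⟩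
        1#                                   ≤⟨ 1≤x^n m 1≤4[1-q₀]^N ⟩
        (fromℕ 4 * (1# - q₀) ^ N) ^ m        ≈⟨ ^-distrib-* _ _ m ⟩
        fromℕ 4 ^ m * ((1# - q₀) ^ N) ^ m    ≈⟨ *-congˡ (≈-trans (^-assocʳ _ N m)
                                                  (≈-trans (^-congʳ _ (ℕ.*-comm N m)) (≈-sym (^-assocʳ _ m N)))) ⟩
        fromℕ 4 ^ m * ((1# - q₀) ^ m) ^ N    ∎))
      where
      open ≤-Reasoning
      x = 1# / ε
      Λ = log (fromℕ 4) x
      L = log (fromℕ 2) (fromℕ k)
      0<4 = fromℕ-positive {4} (s≤s z≤n)

      1≤x : 1# ≤ x
      1≤x = *≤⇒≤/ 0<ε (≤-respˡ (≈-sym (*-identityˡ ε)) (proj₁ ε<1))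

      0<k : 0 ℕ.< k
      0<k = ℕ.≤-trans (ℕ.m^n>0 2 ℓ) 2^ℓ≤k

      ℓ≤L : fromℕ ℓ ≤ L
      ℓ≤L = begin
        fromℕ ℓ               ≈⟨ *-/-cancelʳ (fromℕ ℓ) (fromℕ-positive {1} (s≤s z≤n)) ⟨
        fromℕ ℓ * fromℕ 1 / fromℕ 1  ≈⟨ *-congʳ (≈-trans (*-congˡ fromℕ-1) (*-identityʳ _)) ⟩
        fromℕ ℓ / fromℕ 1     ≤⟨ ≤-log (1<fromℕ {2} ℕ.≤-refl) (≤-respˡ fromℕ-1 (fromℕ-mono-≤ 0<k))
                                   ℓ 1 (suc ℓ) 1 (s≤s z≤n)
                                   (≤-respˡ (fromℕ-^ 2 ℓ) (≤-respʳ (≈-sym (*-identityʳ _)) (fromℕ-mono-≤ 2^ℓ≤k)))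
                                   (s≤s z≤n)
                                   (≤-respˡ (≈-sym (*-identityʳ _)) (≤-respʳ (fromℕ-^ 2 (suc ℓ)) (fromℕ-mono-≤ (ℕ.<⇒≤ k<2^1+ℓ)))) ⟩
        L                     ∎

      0<L : 0# < L
      0<L = <-≤-trans (fromℕ-positive 0<ℓ) ℓ≤L

      T*4L≤kΛ : T * (fromℕ 4 * L) ≤ fromℕ k * Λ
      T*4L≤kΛ = ≤/⇒*≤ (*-positive 0<4 0<L) T≤

      4ℓm≤ckΛ : fromℕ m * (fromℕ 4 * fromℕ ℓ) ≤ fromℕ c * (fromℕ k * Λ)
      4ℓm≤ckΛ = begin
        fromℕ m * (fromℕ 4 * fromℕ ℓ)     ≤⟨ *-monoˡ-≤ (fromℕ-nonNegative m) (*-monoˡ-≤ (proj₁ 0<4) ℓ≤L) ⟩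
        fromℕ m * (fromℕ 4 * L)           ≤⟨ *-monoʳ-≤ (*-nonNegative (proj₁ 0<4) (proj₁ 0<L)) m≤cT ⟩
        fromℕ c * T * (fromℕ 4 * L)       ≈⟨ *-assoc _ _ _ ⟩
        fromℕ c * (T * (fromℕ 4 * L))     ≤⟨ *-monoˡ-≤ (fromℕ-nonNegative c) T*4L≤kΛ ⟩
        fromℕ c * (fromℕ k * Λ)           ∎

      0<Nc : 0 ℕ.< N ℕ.* c
      0<Nc = ℕ.*-mono-≤ 0<N 0<c

      -- The assumption gives log₄ x ≤ m/(Nc). Inserted into 4ℓm ≤ c k log₄ x it yields 4ℓm · 2Mc ≤
      -- ckm, from which mc is cancelled; this is why m must be positive.
      too-slow : 0 ℕ.< m → x ^ (N ℕ.* c) ≤ fromℕ 4 ^ m → 8 ℕ.* (ℓ ℕ.* M) ℕ.≤ k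
      too-slow 0<m x^Nc≤4^m =
        ℕ.*-cancelˡ-≤ (m ℕ.* c) {{ℕ.>-nonZero (ℕ.*-mono-≤ 0<m 0<c)}}
          (≡.subst₂ ℕ._≤_
            (ℕ-solve 4 (λ m ℓ M c → m ℕ:* (ℕcon 4 ℕ:* ℓ) ℕ:* ((M ℕ:+ M) ℕ:* c)
                                    ℕ:= m ℕ:* c ℕ:* (ℕcon 8 ℕ:* (ℓ ℕ:* M))) ≡.refl m ℓ M c)
            (ℕ-solve 3 (λ m c k → c ℕ:* k ℕ:* m ℕ:= m ℕ:* c ℕ:* k) ≡.refl m c k)
            (fromℕ-cancel-≤ {m ℕ.* (4 ℕ.* ℓ) ℕ.* (N ℕ.* c)} {c ℕ.* k ℕ.* m} (begin
              fromℕ (m ℕ.* (4 ℕ.* ℓ) ℕ.* (N ℕ.* c))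
                ≈⟨ ≈-trans (fromℕ-* (m ℕ.* (4 ℕ.* ℓ)) (N ℕ.* c)) (*-congʳ (≈-trans (fromℕ-* m (4 ℕ.* ℓ)) (*-congˡ (fromℕ-* 4 ℓ)))) ⟩
              fromℕ m * (fromℕ 4 * fromℕ ℓ) * fromℕ (N ℕ.* c)
                ≤⟨ *-monoʳ-≤ (fromℕ-nonNegative (N ℕ.* c)) 4ℓm≤ckΛ ⟩
              fromℕ c * (fromℕ k * Λ) * fromℕ (N ℕ.* c)
                ≈⟨ solve 4 (λ c k Λ n → c :* (k :* Λ) :* n := c :* k :* (Λ :* n)) ≈-refl _ _ _ _ ⟩
              fromℕ c * fromℕ k * (Λ * fromℕ (N ℕ.* c))
                ≤⟨ *-monoˡ-≤ (*-nonNegative (fromℕ-nonNegative c) (fromℕ-nonNegative k))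
                     (≤/⇒*≤ (fromℕ-positive 0<Nc)
                       (log-≤ (1<fromℕ {4} (s≤s (s≤s z≤n))) 1≤x m (N ℕ.* c) 0<Nc x^Nc≤4^m)) ⟩
              fromℕ c * fromℕ k * fromℕ m
                ≈⟨ ≈-trans (fromℕ-* (c ℕ.* k) m) (*-congʳ (fromℕ-* c k)) ⟨
              fromℕ (c ℕ.* k ℕ.* m) ∎)))
        where open ℕSolver.+-*-Solver renaming
                (solve to ℕ-solve; _:+_ to _ℕ:+_; _:*_ to _ℕ:*_; _:=_ to _ℕ:=_; con to ℕcon)

      -- Otherwise m / (N c) bounds log₄ x from above, and the slots exceed the budget.
      4^m≤x^Nc : fromℕ 4 ^ m ≤ x ^ (N ℕ.* c)
      4^m≤x^Nc with m ℕ.≟ 0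
      ... | yes m≡0 = ≤-respˡ (≈-reflexive (≡.cong (fromℕ 4 ^_) (≡.sym m≡0))) (1≤x^n (N ℕ.* c) 1≤x)
      ... | no  m≢0 = ≤-stable λ ≰ → ℕ.<⇒≱ k<8ℓM (too-slow (ℕ.n≢0⇒n>0 m≢0) (≰⇒≥ ≰))

-- Series, expectations, and products of independent factors.

module Expectation (𝓡 : Reals) where
  open Reals 𝓡
  open OrderedField 𝓡
  open Estimates 𝓡
  open Probability 𝓡
  open RawSemiringDefinitions (Semiring.rawSemiring semiring) using (product)

  partialSum-nonNegative : ∀ {f} N → (∀ i → 0# ≤ f i) → 0# ≤ partialSum f N
  partialSum-nonNegative zero    0≤f = ≤-refl
  partialSum-nonNegative (suc N) 0≤f = +-nonNegative (0≤f 0) (partialSum-nonNegative N (0≤f ∘ suc))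

  partialSum-mono-≤ : ∀ {f g} N → (∀ i → f i ≤ g i) → partialSum f N ≤ partialSum g N
  partialSum-mono-≤ zero    f≤g = ≤-refl
  partialSum-mono-≤ (suc N) f≤g = +-mono-≤ (f≤g 0) (partialSum-mono-≤ N (f≤g ∘ suc))

  partialSum-monoʳ-≤ : ∀ {f M N} → (∀ i → 0# ≤ f i) → M ℕ.≤ N → partialSum f M ≤ partialSum f N
  partialSum-monoʳ-≤ {N = N} 0≤f z≤n = partialSum-nonNegative N 0≤f
  partialSum-monoʳ-≤ 0≤f (s≤s M≤N)   = +-mono-≤ ≤-refl (partialSum-monoʳ-≤ (0≤f ∘ suc) M≤N)

  partialSum-linear : ∀ f g c N →
    partialSum (λ i → f i + c * g i) N ≈ partialSum f N + c * partialSum g N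
  partialSum-linear f g c zero = ≈-sym (≈-trans (+-identityˡ _) (zeroʳ c))
  partialSum-linear f g c (suc N) = ≈-trans (+-congˡ (partialSum-linear (f ∘ suc) (g ∘ suc) c N))
    (solve 5 (λ x y X Y c → x :+ c :* y :+ (X :+ c :* Y) := x :+ X :+ c :* (y :+ Y)) ≈-refl
      (f 0) (g 0) (partialSum (f ∘ suc) N) (partialSum (g ∘ suc) N) c)

  partialSum-scale : ∀ f c N → partialSum (λ i → c * f i) N ≈ c * partialSum f N
  partialSum-scale f c zero = ≈-sym (zeroʳ c)
  partialSum-scale f c (suc N) = ≈-trans (+-congˡ (partialSum-scale (f ∘ suc) c N))
    (solve 3 (λ x X c → c :* x :+ c :* X := c :* (x :+ X)) ≈-refl (f 0) (partialSum (f ∘ suc) N) c)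

  module _ (f : ℕ → ℝ) {b : ℝ} (bounded : ∀ N → partialSum f N ≤ b) where
    private
      isUpperBound : IsUpperBound (λ x → ∃[ N ] x ≈ partialSum f N) b
      isUpperBound x (N , x≈) = ≤-respˡ (≈-sym x≈) (bounded N)

      isSupremum : IsSupremum (λ x → ∃[ N ] x ≈ partialSum f N) (∑ f)
      isSupremum = sup-isSupremum _ (_ , 0 , ≈-refl) (b , isUpperBound)

    partialSum≤∑ : ∀ N → partialSum f N ≤ ∑ f
    partialSum≤∑ N = proj₁ isSupremum _ (N , ≈-refl)

    ∑≤ : ∑ f ≤ b
    ∑≤ = proj₂ isSupremum b isUpperBound

  UnitValued : {A : Set} → (A → ℝ) → Set
  UnitValued f = ∀ a → 0# ≤ f a × f a ≤ 1#

  module _ {A : Set} (D : Dist A) where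

    partialSum-weight : ∀ N → partialSum (weight D) N ≤ 1#
    partialSum-weight N = proj₁ (total D) _ (N , ≈-refl)

    weighted : (A → ℝ) → ℕ → ℝ
    weighted f i = weight D i * f (value D i)

    module _ {f : A → ℝ} (unit : UnitValued f) where

      term-nonNegative : ∀ i → 0# ≤ weighted f i
      term-nonNegative i = *-nonNegative (nonNegative D i) (proj₁ (unit _))

      partialSum-expectation : ∀ N → partialSum (weighted f) N ≤ 1#
      partialSum-expectation N = ≤-trans
        (partialSum-mono-≤ N λ i →
          ≤-respʳ (*-identityʳ _) (*-monoˡ-≤ (nonNegative D i) (proj₂ (unit (value D i)))))
        (partialSum-weight N)

      𝔼-unit : 0# ≤ 𝔼 D f × 𝔼 D f ≤ 1#
      𝔼-unit = partialSum≤∑ (weighted f) partialSum-expectation 0 , ∑≤ (weighted f) partialSum-expectation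

    𝔼-mono-≤ : ∀ {f g} → UnitValued g → (∀ a → f a ≤ g a) → 𝔼 D f ≤ 𝔼 D g
    𝔼-mono-≤ {f} {g} g-unit f≤g = ∑≤ (weighted f) λ N → ≤-trans
      (partialSum-mono-≤ N λ i → *-monoˡ-≤ (nonNegative D i) (f≤g (value D i)))
      (partialSum≤∑ (weighted g) (partialSum-expectation g-unit) N)

    -- The total weight is 1 only as a supremum, so every partial sum of weights is bounded by the
    -- right side divided by z; z ≤ 0 is treated apart for this reason. Values outside the support
    -- carry no weight, which covers the indices where the assumption is silent.
    𝔼-lower : ∀ {f g z c} → UnitValued f → UnitValued g → 0# ≤ z → 0# ≤ c →
      (∀ a → a ∈supp D → z ≤ f a + c * g a) → z ≤ 𝔼 D f + c * 𝔼 D g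
    𝔼-lower {f} {g} {z} {c} f-unit g-unit 0≤z 0≤c z≤f+cg with z ≤? 0#
    ... | yes z≤0 = ≤-trans z≤0 (+-nonNegative (proj₁ (𝔼-unit f-unit))
                      (*-nonNegative 0≤c (proj₁ (𝔼-unit g-unit))))
    ... | no  z≰0 = ≤-respˡ (*-identityˡ z) (≤/⇒*≤ (≰⇒> z≰0) (proj₂ (total D) _ λ x (N , x≈) →
        ≤-respˡ (≈-sym x≈) (*≤⇒≤/ (≰⇒> z≰0) (begin
          partialSum (weight D) N * z
            ≈⟨ *-comm _ z ⟩
          z * partialSum (weight D) N
            ≈⟨ partialSum-scale (weight D) z N ⟨
          partialSum (λ i → z * weight D i) N
            ≤⟨ partialSum-mono-≤ N pointwise ⟩
          partialSum (λ i → weighted f i + c * weighted g i) N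
            ≈⟨ partialSum-linear (weighted f) (weighted g) c N ⟩
          partialSum (weighted f) N + c * partialSum (weighted g) N
            ≤⟨ +-mono-≤ (partialSum≤∑ (weighted f) (partialSum-expectation f-unit) N)
                 (*-monoˡ-≤ 0≤c (partialSum≤∑ (weighted g) (partialSum-expectation g-unit) N)) ⟩
          𝔼 D f + c * 𝔼 D g ∎))))
      where
      open ≤-Reasoning
      pointwise : ∀ i → z * weight D i ≤ weighted f i + c * weighted g i
      pointwise i with weight D i ≤? 0#
      ... | yes w≤0 = begin
        z * weight D i   ≤⟨ *-monoˡ-≤ 0≤z w≤0 ⟩
        z * 0#           ≈⟨ zeroʳ z ⟩
        0#               ≤⟨ +-nonNegative (term-nonNegative f-unit i)
                              (*-nonNegative 0≤c (term-nonNegative g-unit i)) ⟩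
        weighted f i + c * weighted g i ∎
      ... | no  w≰0 = begin
        z * weight D i
          ≤⟨ *-monoʳ-≤ (nonNegative D i) (z≤f+cg (value D i) (i , ≰⇒> w≰0 , ≡.refl)) ⟩
        (f (value D i) + c * g (value D i)) * weight D i
          ≈⟨ solve 4 (λ f g c w → (f :+ c :* g) :* w := w :* f :+ c :* (w :* g)) ≈-refl _ _ _ _ ⟩
        weighted f i + c * weighted g i ∎

    -- The two expectations are separate suprema, so partial sums with independent lengths M and N
    -- must be bounded together; both are dominated by those of length M + N.
    𝔼-upper : ∀ {f g c} → UnitValued f → UnitValued g → 0# < c →
      (∀ a → f a + c * g a ≤ 1#) → 𝔼 D f + c * 𝔼 D g ≤ 1#
    𝔼-upper {f} {g} {c} f-unit g-unit 0<c f+cg≤1 = ≤-by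
      (0≤y-x (≤-respˡ (*-comm _ c) (≤/⇒*≤ 0<c (∑≤ (weighted g) λ N → *≤⇒≤/ 0<c (≤-by
        (0≤y-x (∑≤ (weighted f) λ M → ≤-by (0≤y-x (both M N))
          (solve 3 (λ F G c → con (+ 1) :- G :* c :- F := con (+ 1) :- (F :+ c :* G)) ≈-refl _ _ c)))
        (solve 3 (λ F G c → con (+ 1) :- F :- G :* c := con (+ 1) :- G :* c :- F) ≈-refl (𝔼 D f) (pG N) c))))))
      (solve 3 (λ F G c → con (+ 1) :- (F :+ c :* G) := con (+ 1) :- F :- c :* G) ≈-refl (𝔼 D f) (𝔼 D g) c)
      where
      open ≤-Reasoning
      pF = partialSum (weighted f)
      pG = partialSum (weighted g)
      both : ∀ M N → pF M + c * pG N ≤ 1#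
      both M N = begin
        pF M + c * pG N
          ≤⟨ +-mono-≤ (partialSum-monoʳ-≤ (term-nonNegative f-unit) (ℕ.m≤m+n M N))
               (*-monoˡ-≤ (proj₁ 0<c) (partialSum-monoʳ-≤ (term-nonNegative g-unit) (ℕ.m≤n+m N M))) ⟩
        pF (M ℕ.+ N) + c * pG (M ℕ.+ N)
          ≈⟨ partialSum-linear (weighted f) (weighted g) c (M ℕ.+ N) ⟨
        partialSum (λ i → weighted f i + c * weighted g i) (M ℕ.+ N)
          ≤⟨ partialSum-mono-≤ (M ℕ.+ N) (λ i →
               ≤-respˡ (solve 4 (λ f g c w → w :* (f :+ c :* g) := w :* f :+ c :* (w :* g)) ≈-refl _ _ _ _)
                 (≤-respʳ (*-identityʳ _) (*-monoˡ-≤ (nonNegative D i) (f+cg≤1 (value D i))))) ⟩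
        partialSum (weight D) (M ℕ.+ N)
          ≤⟨ partialSum-weight (M ℕ.+ N) ⟩
        1# ∎

  product-nonNegative : ∀ {n} {x : Vector ℝ n} → (∀ i → 0# ≤ x i) → 0# ≤ product x
  product-nonNegative {zero}  0≤x = 0≤1
  product-nonNegative {suc n} 0≤x = *-nonNegative (0≤x zero) (product-nonNegative (0≤x ∘ suc))

  1≤product : ∀ {n} {x : Vector ℝ n} → (∀ i → 1# ≤ x i) → 1# ≤ product x
  1≤product {zero}  1≤x = ≤-refl
  1≤product {suc n} 1≤x = ≤-respˡ (*-identityˡ 1#)
    (*-mono-≤ 0≤1 (≤-trans 0≤1 (1≤product (1≤x ∘ suc))) (1≤x zero) (1≤product (1≤x ∘ suc)))

  -- Made for slots with at most one transmission in the clique: the transmitter contributes `half`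
  -- and every other node 1.
  half≤product : ∀ {n} {x : Vector ℝ n} → (∀ i → half ≤ x i) →
    (∀ i j → i ≢ j → ¬ (1# ≤ x i) → 1# ≤ x j) → half ≤ product x
  half≤product {zero}  half≤x others = half≤1
  half≤product {suc n} {x} half≤x others with 1# ≤? x zero
  ... | yes 1≤x₀ = ≤-respˡ (*-identityˡ half)
    (*-mono-≤ 0≤1 (≤-trans half-nonNegative ih) 1≤x₀ ih)
    where ih = half≤product (half≤x ∘ suc) λ i j i≢j → others (suc i) (suc j) (i≢j ∘ suc-injective)
  ... | no  1≰x₀ = ≤-respˡ (*-identityʳ half)
    (*-mono-≤ half-nonNegative (≤-trans 0≤1 1≤rest) (half≤x zero) 1≤rest)
    where 1≤rest = 1≤product λ i → others zero (suc i) (λ ()) 1≰x₀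

  product≤^ : ∀ {n j y} {x : Vector ℝ n} → j ℕ.≤ n → 0# ≤ y →
    (∀ i → 0# ≤ x i) → (∀ i → x i ≤ 1#) → (∀ i → toℕ i ℕ.< j → x i ≤ y) → product x ≤ y ^ j
  product≤^ {zero}  {zero}  _ _ _ _ _ = ≤-refl
  product≤^ {suc n} {zero}  j≤n 0≤y 0≤x x≤1 x≤y = ≤-respʳ (*-identityˡ 1#)
    (*-mono-≤ (0≤x zero) 0≤1 (x≤1 zero)
      (product≤^ {n} {zero} z≤n 0≤y (0≤x ∘ suc) (x≤1 ∘ suc) λ i ()))
  product≤^ {suc n} {suc j} (s≤s j≤n) 0≤y 0≤x x≤1 x≤y =
    *-mono-≤ (0≤x zero) (^-nonNegative j 0≤y) (x≤y zero (s≤s z≤n))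
      (product≤^ j≤n 0≤y (0≤x ∘ suc) (x≤1 ∘ suc) λ i i<j → x≤y (suc i) (s≤s i<j))

  𝔼ⁿ-unit : ∀ {n} {A : Set} (D : Vector (Dist A) n) {F} → UnitValued F → 0# ≤ 𝔼ⁿ D F × 𝔼ⁿ D F ≤ 1#
  𝔼ⁿ-unit {zero}  D unit = unit Vector.[]
  𝔼ⁿ-unit {suc n} D unit =
    𝔼-unit (Vector.head D) λ a → 𝔼ⁿ-unit (Vector.tail D) λ as → unit (a Vector.∷ as)

  -- A union bound with independent factors: the product is an error term that makes up for a small
  -- F on bad outcomes, and independence takes the expectation inside it. Coordinates are drawn one
  -- at a time, and the factor already drawn is absorbed into b, so b has to be arbitrary.
  𝔼ⁿ-lower : ∀ {n} {A : Set} (D : Vector (Dist A) n) {F : Vector A n → ℝ} {g : Fin n → A → ℝ} {b z} →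
    UnitValued F → (∀ v → UnitValued (g v)) → 0# ≤ b → 0# ≤ z →
    (∀ ω → (∀ v → ω v ∈supp D v) → z ≤ F ω + b * product (λ v → g v (ω v))) →
    z ≤ 𝔼ⁿ D F + b * product (λ v → 𝔼 (D v) (g v))
  𝔼ⁿ-lower {zero}  D F-unit g-unit 0≤b 0≤z lower = lower Vector.[] λ ()
  𝔼ⁿ-lower {suc n} D {F} {g} {b} {z} F-unit g-unit 0≤b 0≤z lower =
    ≤-respʳ (+-congˡ (solve 3 (λ b R e → b :* R :* e := b :* (e :* R)) ≈-refl b R (𝔼 (D zero) (g zero))))
      (𝔼-lower (D zero) (λ a → 𝔼ⁿ-unit (Vector.tail D) λ as → F-unit (a Vector.∷ as)) (g-unit zero)
        0≤z (*-nonNegative 0≤b (product-nonNegative λ v → proj₁ (𝔼-unit (D (suc v)) (g-unit (suc v)))))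
        λ a a∈ → ≤-respʳ (+-congˡ (solve 3 (λ b R e → b :* e :* R := b :* R :* e) ≈-refl b R (g zero a)))
          (𝔼ⁿ-lower (Vector.tail D) (λ as → F-unit (a Vector.∷ as)) (g-unit ∘ suc)
            (*-nonNegative 0≤b (proj₁ (g-unit zero a))) 0≤z
            λ as as∈ → ≤-respʳ (+-congˡ (≈-sym (*-assoc _ _ _)))
              (lower (a Vector.∷ as) λ { zero → a∈ ; (suc v) → as∈ v })))
    where R = product (λ v → 𝔼 (D (suc v)) (g (suc v)))

-- Distances and positions on a line.

module Line (𝓡 : Reals) where
  open Reals 𝓡
  open OrderedField 𝓡
  open Estimates 𝓡
  open Network 𝓡

  square-bound : ∀ {x b} → 0# < b → x ≤ b * b → IsUpperBound (λ y → y * y ≤ x) b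
  square-bound {x} {b} 0<b x≤b² y y²≤x = ≤-stable λ y≰b → y≰b
    (*-cancelʳ-≤ (<-≤-trans 0<b (≰⇒≥ y≰b)) (begin
      y * y   ≤⟨ y²≤x ⟩
      x       ≤⟨ x≤b² ⟩
      b * b   ≤⟨ *-monoˡ-≤ (proj₁ 0<b) (≰⇒≥ y≰b) ⟩
      b * y   ∎))
    where open ≤-Reasoning

  √-isSupremum : ∀ {x b} → 0# ≤ x → 0# < b → x ≤ b * b → IsSupremum (λ y → y * y ≤ x) (√ x)
  √-isSupremum 0≤x 0<b x≤b² = sup-isSupremum _
    (0# , ≤-respˡ (≈-sym (zeroˡ 0#)) 0≤x) (_ , square-bound 0<b x≤b²)

  √-≤ : ∀ {x b} → 0# ≤ x → 0# < b → x ≤ b * b → √ x ≤ b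
  √-≤ 0≤x 0<b x≤b² = proj₂ (√-isSupremum 0≤x 0<b x≤b²) _ (square-bound 0<b x≤b²)

  ≤-√ : ∀ {x y} → 0# ≤ x → y * y ≤ x → y ≤ √ x
  -- The supremum needs some upper bound; 1 + x will do, since x ≤ (1 + x)².
  ≤-√ {x} {y} 0≤x = proj₁ (√-isSupremum 0≤x (<-≤-trans 0<1 1≤1+x)
    (≤-by (+-nonNegative (+-nonNegative (x²-nonNegative x) 0≤x) 0≤1)
      (solve 1 (λ x → (con (+ 1) :+ x) :* (con (+ 1) :+ x) :- x := x :* x :+ x :+ con (+ 1)) ≈-refl x))) y
    where
    1≤1+x : 1# ≤ 1# + x
    1≤1+x = ≤-respˡ (+-identityʳ 1#) (+-mono-≤ ≤-refl 0≤x)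

  point : ℝ → Point
  point x = x , 0#

  private
    dist² : ∀ x y → (x - y) * (x - y) + (0# - 0#) * (0# - 0#) ≈ (x - y) * (x - y)
    dist² = solve 2 (λ x y → (x :- y) :* (x :- y) :+ (con (+ 0) :- con (+ 0)) :* (con (+ 0) :- con (+ 0))
                             := (x :- y) :* (x :- y)) ≈-refl

    0≤dist² : ∀ x y → 0# ≤ (x - y) * (x - y) + (0# - 0#) * (0# - 0#)
    0≤dist² x y = ≤-respʳ (≈-sym (dist² x y)) (x²-nonNegative (x - y))

  dist-≤ : ∀ {x y b} → 0# < b → x ≤ y + b → y ≤ x + b → dist (point x) (point y) ≤ b
  dist-≤ {x} {y} {b} 0<b x≤y+b y≤x+b = √-≤ (0≤dist² x y) 0<b (≤-respˡ (≈-sym (dist² x y))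
    (≤-by (*-nonNegative (0≤y-x x≤y+b) (0≤y-x y≤x+b))
      (solve 3 (λ x y b → b :* b :- (x :- y) :* (x :- y) := (y :+ b :- x) :* (x :+ b :- y)) ≈-refl x y b)))

  dist-≤⇒≤ : ∀ {x y b} → dist (point x) (point y) ≤ b → x ≤ y + b
  dist-≤⇒≤ {x} {y} {b} d≤b = ≤-by (0≤y-x (≤-trans
    (≤-√ (0≤dist² x y) (≤-reflexive (≈-sym (dist² x y)))) d≤b))
    (solve 3 (λ x y b → y :+ b :- x := b :- (x :- y)) ≈-refl x y b)

  -- η is min(r, V/2)/n. The first bound keeps every offset within r; the second lets a node pass
  -- between any two of its positions, at most 2nη apart, in one slot.
  spacing : ∀ {n r V} → 0 ℕ.< n → 0# < r → 0# < V →
    ∃[ η ] 0# < η × fromℕ n * η ≤ r × fromℕ n * η + fromℕ n * η ≤ V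
  spacing {n} {r} {V} 0<n 0<r 0<V with r + r ≤? V
  ... | yes 2r≤V = r / fromℕ n , *-positive 0<r (⁻¹-positive 0<fn) ,
        ≤-reflexive n*r/n≈r , ≤-respˡ (≈-sym (+-cong n*r/n≈r n*r/n≈r)) 2r≤V
    where
    0<fn = fromℕ-positive 0<n
    n*r/n≈r : fromℕ n * (r / fromℕ n) ≈ r
    n*r/n≈r = ≈-trans (*-comm _ _) (/-*-cancelʳ r 0<fn)
  ... | no  2r≰V = V * half / fromℕ n ,
        *-positive (*-positive 0<V (⁻¹-positive (fromℕ-positive {2} (s≤s z≤n)))) (⁻¹-positive 0<fn) ,
        ≤-respˡ (≈-sym n*η≈V/2) V/2≤r ,
        ≤-reflexive (≈-trans (+-cong n*η≈V/2 n*η≈V/2) V/2+V/2≈V)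
    where
    open ≤-Reasoning
    0<fn = fromℕ-positive 0<n
    n*η≈V/2 : fromℕ n * (V * half / fromℕ n) ≈ V * half
    n*η≈V/2 = ≈-trans (*-comm _ _) (/-*-cancelʳ (V * half) 0<fn)
    V/2+V/2≈V : V * half + V * half ≈ V
    V/2+V/2≈V = ≈-trans (solve 2 (λ V h → V :* h :+ V :* h := V :* (h :+ h)) ≈-refl V half)
      (≈-trans (*-congˡ half+half) (*-identityʳ V))
    V/2≤r : V * half ≤ r
    V/2≤r = begin
      V * half              ≤⟨ *-monoʳ-≤ half-nonNegative (≰⇒≥ 2r≰V) ⟩
      (r + r) * half        ≈⟨ solve 2 (λ r h → (r :+ r) :* h := r :* (h :+ h)) ≈-refl r half ⟩
      r * (half + half)     ≈⟨ *-congˡ half+half ⟩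
      r * 1#                ≈⟨ *-identityʳ r ⟩
      r                     ∎

  -- Nodes 0, …, k-1 (node 0 being the source) stay within nη of the origin and
  -- the others within nη of r.  Once linked, node k is at r, at distance
  -- exactly r from the source; the other nodes below k are at distance at most
  -- r from it if near, and beyond its reach otherwise.
  module Layout {r η : ℝ} {n k : ℕ} (0<r : 0# < r) (0<η : 0# < η) (nη≤r : fromℕ n * η ≤ r)
                (0<k : 0 ℕ.< k) where

    offset : ℕ → ℝ
    offset i = fromℕ i * η

    -- The near and far positions of the clique are mirror images in the origin, and the source,
    -- with offset 0, is the fixed point of the reflection.
    coordinate : (near linked : Bool) → ℕ → ℝ
    coordinate near linked i with i ℕ.<? k
    ... | yes _ = if near then offset i else - offset i
    ... | no  _ with i ℕ.≟ k
    ...   | yes _ = if linked then r else r + offset i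
    ...   | no  _ = r + offset i

    offset-nonNegative : ∀ i → 0# ≤ offset i
    offset-nonNegative i = *-nonNegative (fromℕ-nonNegative i) (proj₁ 0<η)

    offset-mono-≤ : ∀ {i j} → i ℕ.≤ j → offset i ≤ offset j
    offset-mono-≤ i≤j = *-monoʳ-≤ (proj₁ 0<η) (fromℕ-mono-≤ i≤j)

    offset-cancel-≤ : ∀ {i j} → offset i ≤ offset j → i ℕ.≤ j
    offset-cancel-≤ = fromℕ-cancel-≤ ∘ *-cancelʳ-≤ 0<η

    offset≤r : ∀ {i} → i ℕ.< n → offset i ≤ r
    offset≤r i<n = ≤-trans (offset-mono-≤ (ℕ.<⇒≤ i<n)) nη≤r

    coordinate-near : ∀ {linked i} → i ℕ.< k → coordinate true linked i ≡ offset i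
    coordinate-near {i = i} i<k with i ℕ.<? k
    ... | yes _   = ≡.refl
    ... | no  i≮k = contradiction i<k i≮k

    coordinate-far : ∀ {linked i} → i ℕ.< k → coordinate false linked i ≡ - offset i
    coordinate-far {i = i} i<k with i ℕ.<? k
    ... | yes _   = ≡.refl
    ... | no  i≮k = contradiction i<k i≮k

    coordinate-linked : ∀ {near} → coordinate near true k ≡ r
    coordinate-linked with k ℕ.<? k
    ... | yes k<k = contradiction k<k (ℕ.<-irrefl ≡.refl)
    ... | no  _   with k ℕ.≟ k
    ...   | yes _   = ≡.refl
    ...   | no  k≢k = contradiction ≡.refl k≢k

    coordinate-unlinked : ∀ {near i} → k ℕ.≤ i → coordinate near false i ≡ r + offset i
    coordinate-unlinked {i = i} k≤i with i ℕ.<? k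
    ... | yes i<k = contradiction k≤i (ℕ.<⇒≱ i<k)
    ... | no  _   with i ℕ.≟ k
    ...   | yes _ = ≡.refl
    ...   | no  _ = ≡.refl

    coordinate-outside : ∀ {near linked i} → k ℕ.< i → coordinate near linked i ≡ r + offset i
    coordinate-outside {i = i} k<i with i ℕ.<? k
    ... | yes i<k = contradiction k<i (ℕ.<-asym i<k)
    ... | no  _   with i ℕ.≟ k
    ...   | yes i≡k = contradiction (≡.sym i≡k) (ℕ.<⇒≢ k<i)
    ...   | no  _   = ≡.refl

    clique-bounds : ∀ {near linked i} → i ℕ.< k →
      - offset i ≤ coordinate near linked i × coordinate near linked i ≤ offset i
    clique-bounds {false} {linked} {i} i<k rewrite coordinate-far {linked} i<k =
      ≤-refl , ≤-trans (-‿nonPositive (offset-nonNegative i)) (offset-nonNegative i)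
    clique-bounds {true}  {linked} {i} i<k rewrite coordinate-near {linked} i<k =
      ≤-trans (-‿nonPositive (offset-nonNegative i)) (offset-nonNegative i) , ≤-refl

    outside-bounds : ∀ {near linked i} → k ℕ.≤ i →
      r ≤ coordinate near linked i × coordinate near linked i ≤ r + offset i
    outside-bounds {near} {false} {i} k≤i rewrite coordinate-unlinked {near} k≤i =
      x≤x+y (offset-nonNegative i) , ≤-refl
    outside-bounds {near} {true}  {i} k≤i with ℕ.m≤n⇒m<n∨m≡n k≤i
    ... | inj₁ k<i    rewrite coordinate-outside {near} {true} k<i =
      x≤x+y (offset-nonNegative i) , ≤-refl
    ... | inj₂ ≡.refl rewrite coordinate-linked {near} =
      ≤-refl , x≤x+y (offset-nonNegative i)

    coordinate-distinct-< : ∀ {near linked i j} → i ℕ.< j → j ℕ.< n →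
      ¬ coordinate near linked i ≈ coordinate near linked j
    coordinate-distinct-< {near} {linked} {i} {j} i<j j<n x≈y with ℕ.<-≤-connex j k | ℕ.<-≤-connex i k
    coordinate-distinct-< {true} {linked} {i} {j} i<j j<n x≈y | inj₁ j<k | _ =
      ℕ.<⇒≱ i<j (offset-cancel-≤ (≤-reflexive (≈-sym (≡.subst₂ _≈_
        (coordinate-near (ℕ.<-trans i<j j<k)) (coordinate-near j<k) x≈y))))
    coordinate-distinct-< {false} {linked} {i} {j} i<j j<n x≈y | inj₁ j<k | _ =
      ℕ.<⇒≱ i<j (offset-cancel-≤ (≤-by (0≤y-x (≤-reflexive (≡.subst₂ _≈_
        (coordinate-far (ℕ.<-trans i<j j<k)) (coordinate-far j<k) x≈y)))
        (solve 2 (λ x y → x :- y := :- y :- :- x) ≈-refl (offset i) (offset j))))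
    ... | inj₂ k≤j | inj₁ i<k = ℕ.<⇒≱ (ℕ.<-trans i<j j<n) (offset-cancel-≤ (begin
      offset n                   ≤⟨ nη≤r ⟩
      r                          ≤⟨ proj₁ (outside-bounds k≤j) ⟩
      coordinate near linked j   ≈⟨ x≈y ⟨
      coordinate near linked i   ≤⟨ proj₂ (clique-bounds i<k) ⟩
      offset i                   ∎))
      where open ≤-Reasoning
    -- Since j > i ≥ k, only i can be the linked node, and linking it lowers its coordinate further.
    ... | inj₂ k≤j | inj₂ k≤i = ℕ.<⇒≱ i<j (offset-cancel-≤ (+-cancelˡ-≤ (begin
      r + offset j               ≡⟨ coordinate-outside (ℕ.≤-<-trans k≤i i<j) ⟨
      coordinate near linked j   ≈⟨ x≈y ⟨
      coordinate near linked i   ≤⟨ proj₂ (outside-bounds k≤i) ⟩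
      r + offset i               ∎)))
      where open ≤-Reasoning

    coordinate-distinct : ∀ {near linked i j} → i ≢ j → i ℕ.< n → j ℕ.< n →
      ¬ coordinate near linked i ≈ coordinate near linked j
    coordinate-distinct i≢j i<n j<n x≈y with ℕ.<-cmp _ _
    ... | tri< i<j _ _ = coordinate-distinct-< i<j j<n x≈y
    ... | tri≈ _ i≡j _ = i≢j i≡j
    ... | tri> _ _ j<i = coordinate-distinct-< j<i i<n (≈-sym x≈y)

    coordinate-drift : ∀ {near near′ linked linked′ i} → i ℕ.< n →
      coordinate near linked i ≤ coordinate near′ linked′ i + (fromℕ n * η + fromℕ n * η)
    coordinate-drift {near} {near′} {linked} {linked′} {i} i<n with ℕ.<-≤-connex i k
    ... | inj₁ i<k = begin
      coordinate near linked i
        ≤⟨ proj₂ (clique-bounds i<k) ⟩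
      offset i
        ≤⟨ ≤-by (+-nonNegative (0≤y-x (proj₁ (clique-bounds {near′} {linked′} i<k)))
                  (+-nonNegative (0≤y-x i≤n) (0≤y-x i≤n)))
             (solve 3 (λ x i n → x :+ (n :+ n) :- i := x :- :- i :+ (n :- i :+ (n :- i))) ≈-refl _ _ _) ⟩
      coordinate near′ linked′ i + (offset n + offset n) ∎
      where
      open ≤-Reasoning
      i≤n = offset-mono-≤ (ℕ.<⇒≤ i<n)
    ... | inj₂ k≤i = begin
      coordinate near linked i
        ≤⟨ proj₂ (outside-bounds k≤i) ⟩
      r + offset i
        ≤⟨ +-mono-≤ (proj₁ (outside-bounds k≤i))
             (≤-trans (offset-mono-≤ (ℕ.<⇒≤ i<n)) (x≤x+y (offset-nonNegative n))) ⟩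
      coordinate near′ linked′ i + (offset n + offset n) ∎
      where open ≤-Reasoning

    Near : (near linked : Bool) → ℕ → ℕ → Set
    Near near linked i j = dist (point (coordinate near linked i)) (point (coordinate near linked j)) ≤ r

    offset-0 : offset 0 ≈ 0#
    offset-0 = zeroˡ η

    x≤coordinate-0+x : ∀ {near linked x} → x ≤ coordinate near linked 0 + x
    x≤coordinate-0+x {near} {linked} {x} = ≤-by
      (≤-respˡ (≈-trans (-‿cong offset-0) (solve 0 (:- con (+ 0) := con (+ 0)) ≈-refl))
        (proj₁ (clique-bounds {near} {linked} 0<k)))
      (solve 2 (λ c x → c :+ x :- x := c) ≈-refl _ x)

    coordinate-0≤0 : ∀ {near linked} → coordinate near linked 0 ≤ 0#
    coordinate-0≤0 = ≤-respʳ offset-0 (proj₂ (clique-bounds 0<k))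

    source-near-clique : ∀ {near linked i} → i ℕ.< k → i ℕ.< n → Near near linked 0 i
    source-near-clique {near} {linked} {i} i<k i<n = dist-≤ 0<r
      (≤-trans coordinate-0≤0 (≤-by (+-nonNegative (0≤y-x (proj₁ (clique-bounds {near} {linked} i<k)))
                                                   (0≤y-x (offset≤r i<n)))
        (solve 3 (λ x i r → x :+ r :- con (+ 0) := x :- :- i :+ (r :- i)) ≈-refl _ _ _)))
      (≤-trans (≤-trans (proj₂ (clique-bounds i<k)) (offset≤r i<n)) x≤coordinate-0+x)

    source-near-linked : ∀ {near} → Near near true 0 k
    source-near-linked {near} rewrite coordinate-linked {near} = dist-≤ 0<r
      (≤-trans coordinate-0≤0 (+-nonNegative (proj₁ 0<r) (proj₁ 0<r)))
      x≤coordinate-0+x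

    linked-near-outside : ∀ {near j} → k ℕ.< j → j ℕ.< n → Near near true k j
    linked-near-outside {near} {j} k<j j<n
      rewrite coordinate-linked {near} | coordinate-outside {near} {true} k<j = dist-≤ 0<r
        (≤-trans (x≤x+y (offset-nonNegative j)) (x≤x+y (proj₁ 0<r)))
        (+-mono-≤ ≤-refl (offset≤r j<n))

    linked-near-clique : ∀ {i} → i ℕ.< k → i ℕ.< n → Near true true k i
    linked-near-clique {i} i<k i<n
      rewrite coordinate-linked {true} | coordinate-near {true} i<k = dist-≤ 0<r
        (≤-respʳ (+-comm r _) (x≤x+y (offset-nonNegative i)))
        (≤-trans (offset≤r i<n) (x≤x+y (proj₁ 0<r)))

    -- Offsets increase strictly with the index, so the gap between r + offset i and a clique node
    -- is at least r + offset i - offset w, which exceeds r. The assumption on i admits node k as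
    -- long as it is unlinked.
    outside-apart : ∀ {near linked i w} → coordinate near linked i ≡ r + offset i → w ℕ.< k → k ℕ.≤ i →
      ¬ Near near linked i w
    outside-apart {near} {linked} {i} {w} at-i w<k k≤i close = ℕ.<⇒≱ (ℕ.<-≤-trans w<k k≤i)
      (offset-cancel-≤ (+-cancelˡ-≤ (begin
        r + offset i                   ≡⟨ at-i ⟨
        coordinate near linked i       ≤⟨ dist-≤⇒≤ close ⟩
        coordinate near linked w + r   ≤⟨ +-monoˡ-≤ r (proj₂ (clique-bounds w<k)) ⟩
        offset w + r                   ≈⟨ +-comm _ r ⟩
        r + offset w                   ∎)))
      where open ≤-Reasoning

    -- The distance is r + offset w, so the range is exceeded unless the offset vanishes.
    linked-apart-far : ∀ {w} → w ℕ.< k → Near false true k w → w ≡ 0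
    linked-apart-far {w} w<k close
      rewrite coordinate-linked {false} | coordinate-far {true} w<k =
        ℕ.n≤0⇒n≡0 (offset-cancel-≤ (≤-respʳ (≈-sym offset-0)
          (≤-by (0≤y-x (dist-≤⇒≤ close))
            (solve 2 (λ o r → con (+ 0) :- o := :- o :+ r :- r) ≈-refl _ r))))

-- Counting covered nodes.

∈-tabulate⁺ : ∀ {n} (f : Fin n → Bool) {v} → T (f v) → v ∈ tabulate f
∈-tabulate⁺ f {v} Tfv =
  lookup⇒[]= v (tabulate f) (≡.trans (lookup∘tabulate f v) (Equivalence.to T-≡ Tfv))

∈-tabulate⁻ : ∀ {n} (f : Fin n → Bool) {v} → v ∈ tabulate f → T (f v)
∈-tabulate⁻ f {v} v∈ =
  Equivalence.from T-≡ (≡.trans (≡.sym (lookup∘tabulate f v)) ([]=⇒lookup v∈))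

firstₖ : ∀ n → ℕ → Subset n
firstₖ n k = tabulate λ v → toℕ v ℕ.<ᵇ k

∣firstₖ∣ : ∀ {n k} → k ℕ.≤ n → ∣ firstₖ n k ∣ ≡ k
∣firstₖ∣ {zero}  {zero}  _         = ≡.refl
∣firstₖ∣ {suc n} {zero}  _         = ∣firstₖ∣ {n} z≤n
∣firstₖ∣ {suc n} {suc k} (s≤s k≤n) = ≡.cong suc (∣firstₖ∣ k≤n)

⊆∧∣∣≤⇒⊇ : ∀ {n} {p q : Subset n} → p ⊆ q → ∣ q ∣ ℕ.≤ ∣ p ∣ → q ⊆ p
⊆∧∣∣≤⇒⊇ {p = p} p⊆q ∣q∣≤∣p∣ {v} v∈q with v ∈? p
... | yes v∈p = v∈p
... | no  v∉p = contradiction ∣q∣≤∣p∣ (ℕ.<⇒≱ (p⊂q⇒∣p∣<∣q∣ (p⊆q , v , v∈q , v∉p)))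

¬firstₖ⇒∃ : ∀ {n k} (f : Fin n → Bool) → ¬ (∀ v → toℕ v ℕ.< k → T (f v)) →
  ∃[ v ] toℕ v ℕ.< k × ¬ T (f v)
¬firstₖ⇒∃ {n} {k} f ¬firstₖ with ¬∀⟶∃¬ n _ (λ v → (toℕ v ℕ.<? k) →-dec T? (f v)) ¬firstₖ
... | v , ¬fv with toℕ v ℕ.<? k
...   | yes v<k = v , v<k , λ fv → ¬fv λ _ → fv
...   | no  v≮k = contradiction (λ v<k → contradiction v<k v≮k) ¬fv

module _ {n k : ℕ} (k≤n : k ℕ.≤ n) (f : Fin n → Bool) where

  firstₖ⇒k≤∣∣ : (∀ v → toℕ v ℕ.< k → T (f v)) → k ℕ.≤ ∣ tabulate f ∣
  firstₖ⇒k≤∣∣ firstₖ⊆f = ≡.subst (ℕ._≤ ∣ tabulate f ∣) (∣firstₖ∣ k≤n) (p⊆q⇒∣p∣≤∣q∣ λ {v} v∈ →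
    ∈-tabulate⁺ f (firstₖ⊆f v (ℕ.<ᵇ⇒< _ _ (∈-tabulate⁻ (λ v → toℕ v ℕ.<ᵇ k) v∈))))

  -- A set inside the first k nodes with at least k elements is all of them. This identifies the
  -- covered set at the moment the count reaches k.
  k≤∣∣⇒firstₖ : (∀ v → T (f v) → toℕ v ℕ.< k) → k ℕ.≤ ∣ tabulate f ∣ → ∀ v → toℕ v ℕ.< k → T (f v)
  k≤∣∣⇒firstₖ f⊆firstₖ k≤∣f∣ v v<k = ∈-tabulate⁻ f (⊆∧∣∣≤⇒⊇ {q = firstₖ n k}
    (λ {u} u∈ → ∈-tabulate⁺ (λ v → toℕ v ℕ.<ᵇ k) (ℕ.<⇒<ᵇ (f⊆firstₖ u (∈-tabulate⁻ f u∈))))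
    (≡.subst (ℕ._≤ ∣ tabulate f ∣) (≡.sym (∣firstₖ∣ k≤n)) k≤∣f∣)
    (∈-tabulate⁺ (λ v → toℕ v ℕ.<ᵇ k) (ℕ.<⇒<ᵇ v<k)))

-- The adversary, and the invariants of its network.

module Construction (𝓡 : Reals) where
  open Reals 𝓡
  open Network 𝓡

  module Dynamics (r : ℝ) {n : ℕ} (P : Protocol n) (s : Fin n) (placement : History P → Fin n → Point) where

    open Protocol P
    open Node
    open Adversary

    A : Adversary P
    A = record { source = s ; t₁ = 0 ; position = placement ; active = λ _ _ → true }

    nodes : History P → Fin n → Node P
    nodes = start A

    Covered : History P → Fin n → Set
    Covered h v = T (covered (nodes h v))

    nodes-active : ∀ h v → ∃[ σ ] status (nodes h v) ≡ just σ
    nodes-active h v with (length h ≡ᵇ 0) ∧ does (v ≟ s)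
    ... | true  = _ , ≡.refl
    ... | false = _ , ≡.refl

    final⇒start : ∀ h v → T (covered (final h v)) → Covered h v
    final⇒start h v c with (length h ≡ᵇ 0) ∧ does (v ≟ s)
    ... | true  = tt
    ... | false = c

    -- With all nodes always active, the boundary changes coverage only in slot 0, where the source
    -- obtains I.
    start-covered : ∀ h v → Covered h v → v ≡ s ⊎ T (covered (final h v))
    start-covered []      v c with v ≟ s
    ... | yes v≡s = inj₁ v≡s
    ... | no  _   = inj₂ c
    start-covered (ρ ∷ h) v c = inj₂ c

    update-covered : ∀ {x : Node P} {m c} → T (covered x) → T (covered (update r x m c))
    update-covered {m = nothing} c = c
    update-covered {x} {just σ}  c = Equivalence.from T-∨ (inj₁ c)

    update-covered⁻ : ∀ {x : Node P} {m} c → T (covered (update r x m c)) → T (covered x) ⊎ T (proj₂ c)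
    update-covered⁻ {m = nothing} _ c = inj₁ c
    update-covered⁻ {m = just σ}  _ c = Equivalence.to T-∨ c

    covered-step : ∀ h ω {v} → Covered h v → Covered (extend r A h ω) v
    covered-step h ω {v} = update-covered {nodes h v} {proj₂ (ω v)}

    -- Nobody fails, so I is never lost. Counting refers to `covered`, whereas fairness and the
    -- links of connectivity refer to `informed`.
    covered⇒informed : ∀ {h} → Reachable r A h → ∀ v → Covered h v → T (informed (nodes h v))
    covered⇒informed [] v c with does (v ≟ s)
    ... | true = tt
    covered⇒informed (_▷_ {h} {ω} reach _) v c with proj₂ (ω v)
    ... | nothing = covered⇒informed reach v c
    ... | just _  with Equivalence.to T-∨ c
    ...   | inj₁ before = Equivalence.from T-∨ (inj₁ (covered⇒informed reach v before))
    ...   | inj₂ heard  = Equivalence.from (T-∨ {informed (nodes h v)}) (inj₂ heard)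

    informed⇒covered : ∀ {h} → Reachable r A h → ∀ v → T (informed (nodes h v)) → Covered h v
    informed⇒covered [] v i with does (v ≟ s)
    ... | true = tt
    informed⇒covered (_▷_ {h} {ω} reach _) v i with proj₂ (ω v)
    ... | nothing = informed⇒covered reach v i
    ... | just _  with Equivalence.to T-∨ i
    ...   | inj₁ before = Equivalence.from T-∨ (inj₁ (informed⇒covered reach v before))
    ...   | inj₂ heard  = Equivalence.from (T-∨ {covered (nodes h v)}) (inj₂ heard)

    source-covered : ∀ {h} → Reachable r A h → Covered h s
    source-covered [] rewrite dec-true (s ≟ s) ≡.refl = tt
    source-covered (_▷_ {h} {ω} reach _) = covered-step h ω (source-covered reach)

    heard-informed : ∀ pos (nodes : Fin n → Node P) tx u → T (proj₂ (heard r pos nodes tx u)) →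
      ∃[ v ] ReceivesFrom {P = P} r pos tx u v × T (informed (nodes v))
    heard-informed pos nodes tx u i with any? (receivesFrom? {P = P} r pos tx u)
    ... | yes (v , receives) = v , receives , proj₁ (Equivalence.to T-∧ i)

    Receives : History P → Outcome P → Fin n → Fin n → Set
    Receives h ω = ReceivesFrom {P = P} r (position A h) (proj₁ ∘ ω)

    newly-covered : ∀ {h} ω → Reachable r A h → ∀ u → Covered (extend r A h ω) u →
      Covered h u ⊎ ∃[ w ] Receives h ω u w × Covered h w
    newly-covered {h} ω reach u c
      with update-covered⁻ {nodes h u} {proj₂ (ω u)} (heard r (position A h) (nodes h) (proj₁ ∘ ω) u) c
    ... | inj₁ before = inj₁ before
    ... | inj₂ heard  with heard-informed (position A h) (nodes h) (proj₁ ∘ ω) u heard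
    ...   | w , receives , i = inj₂ (w , receives , informed⇒covered reach w i)

  module Adversarial {Vmax r : ℝ} {n k : ℕ} (0<Vmax : 0# < Vmax) (0<r : 0# < r) (1<k : 1 ℕ.< k) (k<n : k ℕ.< n)
    {η : ℝ} (0<η : 0# < η) (nη≤r : fromℕ n * η ≤ r) (2nη≤Vmax : fromℕ n * η + fromℕ n * η ≤ Vmax)
    {θ : ℝ}
    (P : Protocol n) (fair : Fair r Vmax P) where

    open OrderedField 𝓡
    open Estimates 𝓡
    open Expectation 𝓡
    open Line 𝓡
    open Probability 𝓡
    open Protocol P
    open Node
    open Adversary
    open RawSemiringDefinitions (Semiring.rawSemiring semiring) using (product)

    private
      0<k : 0 ℕ.< k
      0<k = ℕ.<⇒≤ 1<k

      0<n : 0 ℕ.< n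
      0<n = ℕ.<-trans 0<k k<n

    open Layout {r} {η} {n} {k} 0<r 0<η nη≤r 0<k

    s : Fin n
    s = fromℕ< 0<n

    toℕ-s : toℕ s ≡ 0
    toℕ-s = toℕ-fromℕ< 0<n

    -- What happens at the beginning of a slot does not depend on the positions,
    -- so they may be chosen after inspecting the nodes of this motionless network.
    motionless : Adversary P
    motionless = record
      { source = s ; t₁ = 0 ; position = λ _ _ → point 0# ; active = λ _ _ → true }

    CliqueCovered : History P → Set
    CliqueCovered h = ∀ v → toℕ v ℕ.< k → T (covered (start motionless h v))

    cliqueCovered? : ∀ h → Dec (CliqueCovered h)
    cliqueCovered? h = all? λ v → (toℕ v ℕ.<? k) →-dec T? (covered (start motionless h v))

    -- By fairness the source speaks for all covered nodes. `fromMaybe` merely strips the `just` of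
    -- an active node.
    loudness : History P → ℝ
    loudness h = transmitProbability {P = P} (fromMaybe (init s 0) (status (start motionless h s)))

    near : History P → Bool
    near h = not (does (loudness h ≤? θ))

    open Dynamics r P s (λ h v → point (coordinate (near h) (does (cliqueCovered? h)) (toℕ v))) public

    isMANET : IsMANET r Vmax A
    isMANET = record
      { distinct     = λ _ {u} {v} u≢v (x≈y , _) →
          coordinate-distinct (u≢v ∘ toℕ-injective) (toℕ<n u) (toℕ<n v) x≈y
      ; speed        = λ _ _ v → dist-≤ 0<Vmax (drift (toℕ<n v)) (drift (toℕ<n v))
      ; sourceActive = λ _ _ → ≡.refl
      }
      where
      drift : ∀ {b b′ l l′ i} → i ℕ.< n → coordinate b l i ≤ coordinate b′ l′ i + Vmax
      drift i<n = ≤-trans (coordinate-drift i<n) (+-mono-≤ ≤-refl 2nη≤Vmax)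

    simultaneous : ActivatedSimultaneouslyWithoutFailures r A
    simultaneous = 0 , λ _ _ → ≡.refl

    Outsiders : History P → Set
    Outsiders h = ∀ v → k ℕ.≤ toℕ v → ¬ Covered h v

    Stalled : History P → Set
    Stalled h = CliqueCovered h × Outsiders h

    -- A node becomes covered only by hearing an informed node; while no outsider holds I, that
    -- sender belongs to the clique.
    outsiders-step : ∀ {h} ω → Reachable r A h → Outsiders h →
      (∀ u w → k ℕ.≤ toℕ u → toℕ w ℕ.< k → ¬ Receives h ω u w) → Outsiders (extend r A h ω)
    outsiders-step ω reach outsiders silent u k≤u c with newly-covered ω reach u c
    ... | inj₁ before = outsiders u k≤u before
    ... | inj₂ (w , receives , cw) =
      silent u w k≤u (ℕ.≰⇒> λ k≤w → outsiders w k≤w cw) receives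

    outsiders-unlinked-step : ∀ {h} ω → Reachable r A h → Outsiders h → ¬ CliqueCovered h →
      Outsiders (extend r A h ω)
    outsiders-unlinked-step {h} ω reach outsiders ¬linked =
      outsiders-step ω reach outsiders λ u w k≤u w<k ((_ , close) , _) →
        outside-apart {near h} {does (cliqueCovered? h)}
          (≡.trans (≡.cong (λ l → coordinate (near h) l (toℕ u)) (dec-false (cliqueCovered? h) ¬linked))
                   (coordinate-unlinked k≤u))
          w<k k≤u close

    -- The link is withheld until the clique is covered, so no outsider is covered before;
    -- afterwards coverage of the clique persists.
    phase : ∀ {h} → Reachable r A h → CliqueCovered h ⊎ Outsiders h
    phase [] = inj₂ outsiders
      where
      outsiders : Outsiders []
      outsiders v k≤v c with start-covered [] v c
      ... | inj₁ ≡.refl = ℕ.<⇒≱ 0<k (≡.subst (k ℕ.≤_) toℕ-s k≤v)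
    phase (_▷_ {h} {ω} reach _) = [ linked-after , outsiders-after ]′ (phase reach)
      where
      linked-after : CliqueCovered h → CliqueCovered (extend r A h ω) ⊎ Outsiders (extend r A h ω)
      linked-after linked = inj₁ λ v v<k → covered-step h ω (linked v v<k)
      outsiders-after : Outsiders h → CliqueCovered (extend r A h ω) ⊎ Outsiders (extend r A h ω)
      outsiders-after outsiders =
        [ linked-after , inj₂ ∘ outsiders-unlinked-step ω reach outsiders ]′ (toSum (cliqueCovered? h))

    -- The covered set is read at the end of a slot, the link is decided at the next boundary. They
    -- can disagree only on the empty history, where the source has just obtained I; there node 1,
    -- in the clique since k > 1, is uncovered.
    few-covered⇒¬linked : ∀ h → ∣ coveredSet h ∣ ℕ.< k → ¬ CliqueCovered h
    few-covered⇒¬linked [] _ linked with start-covered [] one (linked one one<k)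
      where
      one : Fin n
      one = fromℕ< (ℕ.<-trans 1<k k<n)
      one<k : toℕ one ℕ.< k
      one<k = ≡.subst (ℕ._< k) (≡.sym (toℕ-fromℕ< _)) 1<k
    ... | inj₁ one≡s = contradiction
      (≡.trans (≡.sym (toℕ-fromℕ< _)) (≡.trans (≡.cong toℕ one≡s) toℕ-s)) λ ()
    few-covered⇒¬linked h@(ρ ∷ _) few linked =
      ℕ.<⇒≱ few (firstₖ⇒k≤∣∣ (ℕ.<⇒≤ k<n) (covered ∘ final h) linked)

    -- The crossing slot itself is still unlinked, so it covers no outsider; k covered nodes inside
    -- the clique are then the entire clique.
    crossing⇒stalled : ∀ {h ω} → Reachable r A h →
      ∣ coveredSet h ∣ ℕ.< k → k ℕ.≤ ∣ coveredSet (extend r A h ω) ∣ → Stalled (extend r A h ω)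
    crossing⇒stalled {h} {ω} reach few many =
      k≤∣∣⇒firstₖ (ℕ.<⇒≤ k<n) (covered ∘ final (extend r A h ω))
        (λ v c → ℕ.≰⇒> λ k≤v → outsiders⁺ v k≤v c) many ,
      outsiders⁺
      where
      ¬linked = few-covered⇒¬linked h few
      outsiders⁺ : Outsiders (extend r A h ω)
      outsiders⁺ = outsiders-unlinked-step ω reach
        ([ (λ linked → contradiction linked ¬linked) , (λ outsiders → outsiders) ]′ (phase reach)) ¬linked

    stalled⇒⊆ : ∀ {h h′} → Stalled h′ → (∀ v → toℕ v ℕ.< k → T (covered (final h v))) →
      T (noNewlyCovered r h h′)
    stalled⇒⊆ {h} {h′} (_ , outsiders) covered-h = Equivalence.from T-≡
      (dec-true (coveredSet h′ ⊆? coveredSet h) λ {v} v∈ →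
        ∈-tabulate⁺ (covered ∘ final h) (covered-h v (ℕ.≰⇒> λ k≤v →
          outsiders v k≤v (final⇒start h′ v (∈-tabulate⁻ (covered ∘ final h′) v∈)))))

    -- Nodes beyond k are never within reach of the clique, so only receptions by node k remain to
    -- be excluded.
    stalled-step : ∀ {h} ω → Reachable r A h → Stalled h →
      (∀ u w → toℕ u ≡ k → toℕ w ℕ.< k → ¬ Receives h ω u w) → Stalled (extend r A h ω)
    stalled-step {h} ω reach (linked , outsiders) silent =
      (λ v v<k → covered-step h ω (linked v v<k)) , outsiders-step ω reach outsiders silent′
      where
      silent′ : ∀ u w → k ℕ.≤ toℕ u → toℕ w ℕ.< k → ¬ Receives h ω u w
      silent′ u w k≤u w<k receives@((_ , close) , _) with ℕ.m≤n⇒m<n∨m≡n k≤u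
      ... | inj₁ k<u = outside-apart {near h} {does (cliqueCovered? h)} (coordinate-outside k<u) w<k k≤u close
      ... | inj₂ k≡u = silent u w (≡.sym k≡u) w<k receives

    Transmitting : Outcome P → Fin n → Set
    Transmitting ω v = T (is-just (proj₁ (ω v)))

    far-stalled : ∀ {h} ω → Reachable r A h → Stalled h → near h ≡ false →
      ¬ Transmitting ω s → Stalled (extend r A h ω)
    far-stalled {h} ω reach stalled far quiet = stalled-step ω reach stalled
      λ u w u≡k w<k ((_ , close) , transmits , _) →
        quiet (≡.subst (Transmitting ω)
          (toℕ-injective (≡.trans (linked-apart-far w<k (≡.subst₂ (λ b l → Near b l k (toℕ w)) far
            (dec-true (cliqueCovered? h) (proj₁ stalled))
            (≡.subst (λ i → Near (near h) (does (cliqueCovered? h)) i (toℕ w)) u≡k close))) (≡.sym toℕ-s)))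
          transmits)

    near-stalled : ∀ {h} ω → Reachable r A h → Stalled h → near h ≡ true →
      ∀ {v w} → v ≢ w → toℕ v ℕ.< k → toℕ w ℕ.< k → Transmitting ω v → Transmitting ω w →
      Stalled (extend r A h ω)
    near-stalled {h} ω reach stalled nearby {v} {w} v≢w v<k w<k tv tw = stalled-step ω reach stalled
      λ u x u≡k x<k (_ , _ , only) →
        v≢w (≡.trans (only v (inj₂ (neighbours u v u≡k v<k)) tv)
                     (≡.sym (only w (inj₂ (neighbours u w u≡k w<k)) tw)))
      where
      neighbours : ∀ u v → toℕ u ≡ k → toℕ v ℕ.< k → Neighbours {P = P} r (position A h) u v
      neighbours u v u≡k v<k = (λ { ≡.refl → ℕ.<-irrefl u≡k v<k }) ,
        ≡.subst (λ i → Near (near h) (does (cliqueCovered? h)) i (toℕ v)) (≡.sym u≡k)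
          (≡.subst₂ (λ b l → Near b l k (toℕ v)) (≡.sym nearby)
            (≡.sym (dec-true (cliqueCovered? h) (proj₁ stalled))) (linked-near-clique v<k (toℕ<n v)))

    K : Fin n
    K = fromℕ< k<n

    toℕ-K : toℕ K ≡ k
    toℕ-K = toℕ-fromℕ< k<n

    -- Connectivity.

    module _ {α β : ℕ} {d : ℝ} (0<β : 0 ℕ.< β) (ω : ℕ → Outcome P) (isExecution : IsExecution r A ω) where

      private
        h = history r A ω

        reachable : ∀ t → Reachable r A (h t)
        reachable zero    = []
        reachable (suc t) = reachable t ▷ isExecution t

        covered-mono : ∀ {t t′ v} → t ℕ.≤ t′ → Covered (h t) v → Covered (h t′) v
        covered-mono {t} {t′} {v} t≤t′ = go (ℕ.≤⇒≤′ t≤t′)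
          where
          go : ∀ {t′} → t ℕ.≤′ t′ → Covered (h t) v → Covered (h t′) v
          go ℕ.≤′-refl            c = c
          go (ℕ.≤′-step {n} t≤n) c = covered-step (h n) (ω n) (go t≤n c)

        Close : ℕ → Fin n → Fin n → Set
        Close t u v = Near (near (h t)) (does (cliqueCovered? (h t))) (toℕ u) (toℕ v)

        link : ∀ {t} p p′ → Covered (h t) p → ¬ Covered (h t) p′ →
          (∀ t′ → t ℕ.≤ t′ → Close t′ p p′) → Linked r A d ω β t
        link {t} p p′ cp ¬cp′ close =
          p , p′ , covered⇒informed (reachable t) p cp , ¬cp′ , λ t′ t≤t′ _ _ →
          tt , tt , (λ { ≡.refl → ¬cp′ cp }) , close t′ t≤t′

        close-linked : ∀ {t t′ i j u v} → t ℕ.≤ t′ → CliqueCovered (h t) → toℕ u ≡ i → toℕ v ≡ j →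
          Near (near (h t′)) true i j → Close t′ u v
        close-linked {t} {t′} {i} {j} {u} {v} t≤t′ linked u≡i v≡j =
          ≡.subst (λ l → Near (near (h t′)) l (toℕ u) (toℕ v))
            (≡.sym (dec-true (cliqueCovered? (h t′)) λ w w<k → covered-mono t≤t′ (linked w w<k)))
          ∘ ≡.subst₂ (Near (near (h t′)) true) (≡.sym u≡i) (≡.sym v≡j)

        -- Depending on the progress, the link is from the source to a clique node, from the source
        -- to node k, or from node k to a node beyond it. Each is independent of near and far and,
        -- once available, lasts forever, because coverage of the clique is permanent.
        informative-link : ∀ t → (∃[ v ] ¬ Covered (h t) v) → Linked r A d ω β t
        informative-link t (v , ¬cv) = [ from-linked , from-unlinked ]′ (toSum (cliqueCovered? (h t)))
          where
          from-unlinked : ¬ CliqueCovered (h t) → Linked r A d ω β t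
          from-unlinked ¬linked =
            let w , w<k , ¬cw = ¬firstₖ⇒∃ (covered ∘ nodes (h t)) ¬linked in
            link s w (source-covered (reachable t)) ¬cw λ t′ _ →
              ≡.subst (λ i → Near (near (h t′)) (does (cliqueCovered? (h t′))) i (toℕ w)) (≡.sym toℕ-s) (source-near-clique w<k (toℕ<n w))

          from-linked : CliqueCovered (h t) → Linked r A d ω β t
          from-linked linked = [ from-K , to-K ]′ (toSum (T? (covered (nodes (h t) K))))
            where
            to-K : ¬ Covered (h t) K → Linked r A d ω β t
            to-K ¬cK = link s K (source-covered (reachable t)) ¬cK λ t′ t≤t′ →
              close-linked t≤t′ linked toℕ-s toℕ-K source-near-linked

            from-K : Covered (h t) K → Linked r A d ω β t
            from-K cK = link K v cK ¬cv λ t′ t≤t′ →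
              close-linked t≤t′ linked toℕ-K ≡.refl (linked-near-outside k<v (toℕ<n v))
              where
              k<v : k ℕ.< toℕ v
              k<v = ℕ.≤∧≢⇒< (ℕ.≮⇒≥ λ v<k → ¬cv (linked v v<k)) λ k≡v →
                ¬cv (≡.subst (Covered (h t)) (toℕ-injective (≡.trans toℕ-K k≡v)) cK)

      connectedAlong : ConnectedAlong r A d ω α β
      connectedAlong t _ ¬solved =
        -- The window starts in slot t itself and contains it because β > 0.
        t , (t , ℕ.≤-refl , ℕ.m≤m+n t α , ℕ.≤-refl , ℕ.m<m+n t 0<β) ,
        informative-link t (¬∀⟶∃¬ n _ (λ v → T? (covered (nodes (h t) v))) λ all → ¬solved λ v _ → all v)

    -- Probability that a slot covers no new node.

    Draw : Set
    Draw = Maybe Message × Maybe State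

    transmits : Draw → Bool
    transmits = is-just ∘ proj₁

    draws : History P → Fin n → Dist Draw
    draws h v = law (length h) v (nodes h v)

    indicator-unit : ∀ b → 0# ≤ indicator b × indicator b ≤ 1#
    indicator-unit true  = 0≤1 , ≤-refl
    indicator-unit false = ≤-refl , 0≤1

    Pr-unit : ∀ m E h → 0# ≤ Pr r A m E h × Pr r A m E h ≤ 1#
    Pr-unit zero    E h = indicator-unit (E h)
    Pr-unit (suc m) E h = 𝔼ⁿ-unit (draws h) λ ω → Pr-unit m E (extend r A h ω)

    law-transmits : ∀ t v x {σ} → status x ≡ just σ →
      𝔼 (law {P = P} t v x) (indicator ∘ transmits) ≡ transmitProbability {P = P} σ
    law-transmits t v x eq rewrite eq = ≡.refl

    loudness-status : ∀ h {σ} → status (nodes h s) ≡ just σ → loudness h ≡ transmitProbability {P = P} σ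
    loudness-status h eq = ≡.cong (λ x → transmitProbability {P = P} (fromMaybe (init s 0) x)) eq

    equally-loud : ∀ {h} → Reachable r A h → ∀ {v} → Covered h v →
      𝔼 (draws h v) (indicator ∘ transmits) ≈ loudness h
    equally-loud {h} reach {v} cv with nodes-active h v | nodes-active h s
    ... | σ , v-σ | τ , s-τ = ≈-trans (≈-reflexive (law-transmits (length h) v (nodes h v) v-σ)) (≈-trans
      (fair A isMANET reach v s v-σ s-τ (covered⇒informed reach v cv)
        (covered⇒informed reach s (source-covered reach)))
      (≈-reflexive (≡.sym (loudness-status h s-τ))))

    loudness≤1 : ∀ h → loudness h ≤ 1#
    loudness≤1 h = proj₂ (𝔼-unit (act _) (indicator-unit ∘ is-just ∘ proj₁))

    -- The factor of node v in a product of independent factors that is to bound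
    -- the probability of an unwanted transmission pattern of the nodes below j.
    factor : ℕ → (a b : ℝ) → Fin n → Draw → ℝ
    factor j a b v o = if toℕ v ℕ.<ᵇ j then (if transmits o then a else b) else 1#

    -- Indexed by the value of the factor, so that matching on the view also replaces the nested
    -- conditionals by that value.
    data FactorView (j : ℕ) (a b : ℝ) (v : Fin n) (o : Draw) : ℝ → Set where
      loud    : toℕ v ℕ.< j → T (transmits o) → FactorView j a b v o a
      silent  : toℕ v ℕ.< j → ¬ T (transmits o) → FactorView j a b v o b
      neutral : ¬ toℕ v ℕ.< j → FactorView j a b v o 1#

    factorView : ∀ j a b v o → FactorView j a b v o (factor j a b v o)
    factorView j a b v o with toℕ v ℕ.<ᵇ j in lt
    ... | false = neutral λ v<j → ≡.subst T lt (ℕ.<⇒<ᵇ v<j)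
    ... | true  with transmits o in tr
    ...   | true  = loud (ℕ.<ᵇ⇒< _ _ (≡.subst T (≡.sym lt) tt)) (≡.subst T (≡.sym tr) tt)
    ...   | false = silent (ℕ.<ᵇ⇒< _ _ (≡.subst T (≡.sym lt) tt)) (≡.subst T tr)

    factor-unit : ∀ {j a b} → 0# ≤ a × a ≤ 1# → 0# ≤ b × b ≤ 1# → ∀ v → UnitValued (factor j a b v)
    factor-unit {j} {a} {b} a-unit b-unit v o with factor j a b v o | factorView j a b v o
    ... | _ | loud _ _   = a-unit
    ... | _ | silent _ _ = b-unit
    ... | _ | neutral _  = 0≤1 , ≤-refl

    0#-unit : 0# ≤ 0# × 0# ≤ 1#
    0#-unit = ≤-refl , 0≤1

    1#-unit : 0# ≤ 1# × 1# ≤ 1#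
    1#-unit = 0≤1 , ≤-refl

    half-unit : 0# ≤ half × half ≤ 1#
    half-unit = half-nonNegative , half≤1

    product-factor-nonNegative : ∀ j {a b} → 0# ≤ a × a ≤ 1# → 0# ≤ b × b ≤ 1# → (ω : Outcome P) →
      0# ≤ product (λ v → factor j a b v (ω v))
    product-factor-nonNegative j {a} {b} a-unit b-unit ω =
      product-nonNegative {x = λ v → factor j a b v (ω v)} λ v → proj₁ (factor-unit {j} a-unit b-unit v (ω v))

    -- With j = 1 and the values 1 and 0, the product of the factors is the indicator of a
    -- transmission by the source.
    factor≤indicator : ∀ {v} → toℕ v ℕ.< 1 → ∀ o → factor 1 1# 0# v o ≤ indicator (transmits o)
    factor≤indicator {v} v<1 o with factor 1 1# 0# v o | factorView 1 1# 0# v o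
    ... | _ | loud _ t     = ≤-reflexive (≈-reflexive (≡.cong indicator (≡.sym (Equivalence.to T-≡ t))))
    ... | _ | silent _ _   = proj₁ (indicator-unit (transmits o))
    ... | _ | neutral v≮1  = contradiction v<1 v≮1

    1≤product-factor : ∀ ω → Transmitting ω s → 1# ≤ product (λ v → factor 1 1# 0# v (ω v))
    1≤product-factor ω t = 1≤product 1≤factor
      where
      1≤factor : ∀ v → 1# ≤ factor 1 1# 0# v (ω v)
      1≤factor v with factor 1 1# 0# v (ω v) | factorView 1 1# 0# v (ω v)
      ... | _ | loud _ _      = ≤-refl
      ... | _ | neutral _     = ≤-refl
      ... | _ | silent v<1 ¬t = contradiction
        (≡.subst (Transmitting ω) (toℕ-injective (≡.trans toℕ-s (≡.sym (ℕ.n<1⇒n≡0 v<1)))) t) ¬t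

    -- The factor is one coordinate of 2^(-X), for X the number of transmitters in the clique; its
    -- expectation is at most 1 - p/2.
    factor+indicator≤1 : ∀ {v} → toℕ v ℕ.< k → ∀ o →
      factor k half 1# v o + half * indicator (transmits o) ≤ 1#
    factor+indicator≤1 {v} v<k o with factor k half 1# v o | factorView k half 1# v o
    ... | _ | loud _ t rewrite Equivalence.to T-≡ t =
      ≤-reflexive (≈-trans (+-congˡ (*-identityʳ half)) half+half)
    ... | _ | neutral v≮k = contradiction v<k v≮k
    ... | _ | silent _ ¬t with transmits o
    ...   | true  = contradiction tt ¬t
    ...   | false = ≤-reflexive (≈-trans (+-congˡ (zeroʳ half)) (+-identityʳ 1#))

    TwoTransmitting : Outcome P → Set
    TwoTransmitting ω = ∃₂ λ v w →
      v ≢ w × toℕ v ℕ.< k × toℕ w ℕ.< k × Transmitting ω v × Transmitting ω w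

    twoTransmitting? : ∀ ω → Dec (TwoTransmitting ω)
    twoTransmitting? ω = any? λ v → any? λ w → ¬? (v ≟ w) ×-dec (toℕ v ℕ.<? k) ×-dec (toℕ w ℕ.<? k)
      ×-dec T? (transmits (ω v)) ×-dec T? (transmits (ω w))

    half≤product-factor : ∀ ω → ¬ TwoTransmitting ω → half ≤ product (λ v → factor k half 1# v (ω v))
    half≤product-factor ω ¬two = half≤product half≤factor others
      where
      half≤factor : ∀ v → half ≤ factor k half 1# v (ω v)
      half≤factor v with factor k half 1# v (ω v) | factorView k half 1# v (ω v)
      ... | _ | loud _ _   = ≤-refl
      ... | _ | silent _ _ = half≤1
      ... | _ | neutral _  = half≤1

      others : ∀ v w → v ≢ w → ¬ 1# ≤ factor k half 1# v (ω v) → 1# ≤ factor k half 1# w (ω w)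
      others v w v≢w ≰ with factor k half 1# v (ω v) | factorView k half 1# v (ω v)
                          | factor k half 1# w (ω w) | factorView k half 1# w (ω w)
      ... | _ | silent _ _   | _ | _            = contradiction ≤-refl ≰
      ... | _ | neutral _    | _ | _            = contradiction ≤-refl ≰
      ... | _ | loud _ _     | _ | silent _ _   = ≤-refl
      ... | _ | loud _ _     | _ | neutral _    = ≤-refl
      ... | _ | loud v<k tv  | _ | loud w<k tw  = contradiction (v , w , v≢w , v<k , w<k , tv , tw) ¬two

    -- Common to both tactics: the error term lifts F to z even on outcomes that may cover node k,
    -- and its expectation is at most b y^j ≤ zθ.
    slot-bound : ∀ {h F z b j a a′ y} → UnitValued F → 0# ≤ b → 0# ≤ z → 0# ≤ y → j ℕ.≤ n →
      0# ≤ a × a ≤ 1# → 0# ≤ a′ × a′ ≤ 1# →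
      (∀ v → toℕ v ℕ.< j → 𝔼 (draws h v) (factor j a a′ v) ≤ y) →
      (∀ ω → Possible A h ω → z ≤ F ω + b * product (λ v → factor j a a′ v (ω v))) →
      b * y ^ j ≤ z * θ → (1# - θ) * z ≤ 𝔼ⁿ (draws h) F
    slot-bound {h} {F} {z} {b} {j} {a} {a′} {y} F-unit 0≤b 0≤z 0≤y j≤n a-unit a′-unit factor≤y lower by≤zθ =
      ≤-by (+-nonNegative (0≤y-x (𝔼ⁿ-lower (draws h) F-unit g-unit 0≤b 0≤z lower))
             (0≤y-x (≤-trans (*-monoˡ-≤ 0≤b (product≤^ j≤n 0≤y
               (λ v → proj₁ (𝔼-unit (draws h v) (g-unit v)))
               (λ v → proj₂ (𝔼-unit (draws h v) (g-unit v))) factor≤y)) by≤zθ)))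
        (solve 4 (λ E z θ p → E :- (con (+ 1) :- θ) :* z := E :+ p :- z :+ (z :* θ :- p)) ≈-refl _ z θ _)
      where g-unit = factor-unit {j} a-unit a′-unit

    module _ (0≤1-θ : 0# ≤ 1# - θ) (0≤θ : 0# ≤ θ)
      (chernoff : ∀ {p} → θ ≤ p → p ≤ 1# → fromℕ 2 * (1# - half * p) ^ k ≤ θ) where

      module _ {h : History P} (reach : Reachable r A h) (stalled : Stalled h)
        {F : Outcome P → ℝ} {z : ℝ} (F-unit : UnitValued F) (0≤z : 0# ≤ z)
        (F-stalled : ∀ ω → Possible A h ω → Stalled (extend r A h ω) → z ≤ F ω) where

        far-slot : near h ≡ false → loudness h ≤ θ → (1# - θ) * z ≤ 𝔼ⁿ (draws h) F
        far-slot far quiet = slot-bound {h} {j = 1} F-unit 0≤z 0≤z 0≤θ 0<n 1#-unit 0#-unit factor≤θ lower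
          (*-monoˡ-≤ 0≤z (≤-reflexive (*-identityʳ θ)))
          where
          factor≤θ : ∀ v → toℕ v ℕ.< 1 → 𝔼 (draws h v) (factor 1 1# 0# v) ≤ θ
          factor≤θ v v<1 = ≤-trans (𝔼-mono-≤ (draws h v) {factor 1 1# 0# v}
              (indicator-unit ∘ transmits) (factor≤indicator v<1))
            (≤-trans (≤-reflexive (equally-loud reach (proj₁ stalled v (ℕ.≤-trans v<1 0<k)))) quiet)

          lower : ∀ ω → Possible A h ω → z ≤ F ω + z * product (λ v → factor 1 1# 0# v (ω v))
          lower ω possible = [ source-loud , source-quiet ]′ (toSum (T? (transmits (ω s))))
            where
            source-loud : Transmitting ω s → z ≤ F ω + z * product (λ v → factor 1 1# 0# v (ω v))
            source-loud t = ≤-respˡ (≈-trans (+-identityˡ _) (*-identityʳ z))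
              (+-mono-≤ (proj₁ (F-unit ω)) (*-monoˡ-≤ 0≤z (1≤product-factor ω t)))

            source-quiet : ¬ Transmitting ω s → z ≤ F ω + z * product (λ v → factor 1 1# 0# v (ω v))
            source-quiet ¬t = ≤-trans (F-stalled ω possible (far-stalled ω reach stalled far ¬t))
              (x≤x+y (*-nonNegative 0≤z (product-factor-nonNegative 1 1#-unit 0#-unit ω)))

        -- Chernoff: 2 E[2^-X] bounds the probability that the number X of
        -- transmitting nodes is at most one.
        near-slot : near h ≡ true → θ ≤ loudness h → (1# - θ) * z ≤ 𝔼ⁿ (draws h) F
        near-slot nearby loud≥θ = slot-bound {h} {j = k} F-unit 0≤2z 0≤z (1-half*p-nonNegative (loudness≤1 h)) (ℕ.<⇒≤ k<n) half-unit 1#-unit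
          factor≤y lower (≤-respˡ (≈-trans (≈-sym (*-assoc z _ _)) (*-congʳ (*-comm z _)))
            (*-monoˡ-≤ 0≤z (chernoff loud≥θ (loudness≤1 h))))
          where
          open ≤-Reasoning
          0≤2z : 0# ≤ fromℕ 2 * z
          0≤2z = *-nonNegative (fromℕ-nonNegative 2) 0≤z

          0<half : 0# < half
          0<half = ⁻¹-positive (fromℕ-positive {2} (s≤s z≤n))

          factor≤y : ∀ v → toℕ v ℕ.< k → 𝔼 (draws h v) (factor k half 1# v) ≤ 1# - half * loudness h
          factor≤y v v<k = ≤-by (0≤y-x (𝔼-upper (draws h v) {factor k half 1# v} (factor-unit {k} half-unit 1#-unit v)
              (indicator-unit ∘ transmits) 0<half (factor+indicator≤1 v<k)))
            (≈-trans (+-congʳ (+-congˡ (-‿cong (*-congˡ (≈-sym (equally-loud reach (proj₁ stalled v v<k)))))))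
              (solve 3 (λ E H p → con (+ 1) :- H :* p :- E := con (+ 1) :- (E :+ H :* p)) ≈-refl _ half _))

          lower : ∀ ω → Possible A h ω → z ≤ F ω + fromℕ 2 * z * product (λ v → factor k half 1# v (ω v))
          lower ω possible = [ two , one ]′ (toSum (twoTransmitting? ω))
            where
            two : TwoTransmitting ω → z ≤ F ω + fromℕ 2 * z * product (λ v → factor k half 1# v (ω v))
            two (v , w , v≢w , v<k , w<k , tv , tw) =
              ≤-trans (F-stalled ω possible (near-stalled ω reach stalled nearby v≢w v<k w<k tv tw))
                (x≤x+y (*-nonNegative 0≤2z (product-factor-nonNegative k half-unit 1#-unit ω)))

            one : ¬ TwoTransmitting ω → z ≤ F ω + fromℕ 2 * z * product (λ v → factor k half 1# v (ω v))
            one ¬two = begin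
              z                            ≈⟨ *-identityˡ z ⟨
              1# * z                       ≈⟨ *-congʳ (*-inverse-fromℕ {2} (s≤s z≤n)) ⟨
              fromℕ 2 * half * z           ≈⟨ solve 3 (λ t h z → t :* h :* z := con (+ 0) :+ t :* z :* h) ≈-refl (fromℕ 2) half z ⟩
              0# + fromℕ 2 * z * half      ≤⟨ +-mono-≤ (proj₁ (F-unit ω)) (*-monoˡ-≤ 0≤2z (half≤product-factor ω ¬two)) ⟩
              F ω + fromℕ 2 * z * product (λ v → factor k half 1# v (ω v)) ∎

        stalling-slot : (1# - θ) * z ≤ 𝔼ⁿ (draws h) F
        stalling-slot = [ quiet-slot , loud-slot ]′ (toSum (loudness h ≤? θ))
          where
          quiet-slot : loudness h ≤ θ → (1# - θ) * z ≤ 𝔼ⁿ (draws h) F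
          quiet-slot p≤θ = far-slot (≡.cong not (dec-true (loudness h ≤? θ) p≤θ)) p≤θ

          loud-slot : ¬ loudness h ≤ θ → (1# - θ) * z ≤ 𝔼ⁿ (draws h) F
          loud-slot p≰θ = near-slot (≡.cong not (dec-false (loudness h ≤? θ) p≰θ)) (≰⇒≥ p≰θ)

      -- The bound on one slot holds from every reachable stalled history, with z the bound for the
      -- remaining slots; the factors 1 - θ therefore multiply despite adaptivity.
      stalling : ∀ {E : History P → Bool} → (∀ h → Stalled h → T (E h)) →
        ∀ m {h} → Reachable r A h → Stalled h → (1# - θ) ^ m ≤ Pr r A m E h
      stalling {E} stalled⇒E zero {h} reach stalled =
        ≤-reflexive (≈-reflexive (≡.cong indicator (≡.sym (Equivalence.to T-≡ (stalled⇒E h stalled)))))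
      stalling {E} stalled⇒E (suc m) {h} reach stalled =
        stalling-slot reach stalled (λ ω → Pr-unit m E (extend r A h ω)) (^-nonNegative m 0≤1-θ)
          λ ω possible stalled⁺ → stalling stalled⇒E m (reach ▷ possible) stalled⁺

theorem6 : (𝓡 : Reals) → let open Reals 𝓡 in let open Network 𝓡 in
    (Vmax r d ε : ℝ) (α β n k c : ℕ) →
    0# < Vmax → 0# < r → r < d → 0# < ε → ε < 1# →
    0 ℕ.< β → 45 ℕ.≤ k → k ℕ.< n → 0 ℕ.< c →
    (P : Protocol n) → Conditional r Vmax P → Fair r Vmax P →
    Σ[ A ∈ Adversary P ]
    IsMANET r Vmax A ×
    Connected r α β d A ×
    ActivatedSimultaneouslyWithoutFailures r A ×
    ((T : ℝ) →
    T ≤ (fromℕ k * log (fromℕ 4) (1# / ε)) / (fromℕ 4 * log (fromℕ 2) (fromℕ k)) →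
    ∀ {h ω} → Reachable r A h → Possible A h ω →
    ∣ coveredSet h ∣ ℕ.< k → k ℕ.≤ ∣ coveredSet (extend r A h ω) ∣ →
    (m : ℕ) → fromℕ m ≤ fromℕ c * T →
    ε ^ c ≤ Pr r A m (noNewlyCovered r (extend r A h ω)) (extend r A h ω))
theorem6 𝓡 Vmax r d ε α β n k c 0<Vmax 0<r r<d 0<ε ε<1 0<β 45≤k k<n 0<c P conditional fair =
  A , isMANET , (λ ω isExecution → connectedAlong 0<β ω isExecution) , simultaneous ,
  λ T T≤ {h} {ω} reach possible few many m m≤cT → ≤-trans
    (survival-bound 0<M {ℓ = ℓ} {c} {m} 0<ε ε<1 0<ℓ 2^ℓ≤k k<2^1+ℓ k<8ℓM 0<c T≤ m≤cT)
    (stalling (1-q₀-nonNegative 0<M) (0≤q₀ 0<M) (silence-bound 0<M 4Mℓ≤k 4M≤2^ℓ)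
      -- The reference history ends with the crossing slot, where the clique is already covered; a
      -- later stalled history has nothing beyond it.
      (λ h′ stalled → stalled⇒⊆ {extend r A h ω} {h′} stalled (proj₁ (crossing⇒stalled {h} {ω} reach few many)))
      m (reach ▷ possible) (crossing⇒stalled {h} {ω} reach few many))
  where
  open Reals 𝓡
  open Network 𝓡
  open OrderedField 𝓡 using (≤-trans)
  open Estimates 𝓡
  open Threshold (threshold 45≤k)
  spaced = Line.spacing 𝓡 (ℕ.≤-trans (ℕ.s≤s ℕ.z≤n) k<n) 0<r 0<Vmax
  open Construction.Adversarial 𝓡 0<Vmax 0<r (ℕ.≤-trans (ℕ.s≤s (ℕ.s≤s ℕ.z≤n)) 45≤k) k<n
    (proj₁ (proj₂ spaced)) (proj₁ (proj₂ (proj₂ spaced))) (proj₂ (proj₂ (proj₂ spaced))) {q₀ 0<M} P fair
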